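{- Over the class of all Kripke trees: $\mathrm{MSO}\not\sim\mathrm{WMSO}$, $\mathrm{MTL}\not\sim\mathrm{WMTL}$, $\mathrm{MSO}\not\sim\mathrm{WMTL}$, and $\mathrm{MTL}\not\sim\mathrm{WMSO}$. Over the class of finitely-branching Kripke trees: $\mathrm{WMSO}<\mathrm{MSO}$, $\mathrm{WMTL}<\mathrm{MTL}$, and $\mathrm{MTL}\not\sim\mathrm{WMSO}$.
   Context: Trees. A tree $T$ is a subset of $\mathbb{N}^*$ (finite words over the naturals) with an element $\tau_0\in T$ (the root) such that every $\tau\in T$ has the form $\tau_0\cdot\tau'$ with $\tau'\in\mathbb{N}^*$, and whenever $\tau_0\cdot\tau\in T$ and $\tau'$ is a prefix of $\tau$, also $\tau_0\cdot\tau'\in T$. Elements of $T$ are nodes. A child of $\tau$ in $T$ is a node of $T$ of the form $\tau\cdot n$, $n\in\mathbb{N}$; a descendant of $\tau$ in $T$ is a node of $T$ of the form $\tau\cdot\tau'$, $\tau'\in\mathbb{N}^*$ (so $\tau$ is a descendant of itself). A subtree of $T$ is a subset of $T$ that is a tree (with any root). $T$ is non-blocking if every node has a child in $T$, and finitely-branching if every node has finitely many children in $T$. For a finite set $AP$ of atomic propositions, a Kripke tree over $AP$ is a pair $(T,\mathrm{Lab})$ with $T$ a non-blocking tree and $\mathrm{Lab}:T\to 2^{AP}$; it is finitely-branching if $T$ is. Logics. Formulas over $AP$ are generated by $\varphi ::= P_a(x)\mid x\le y\mid x\in X\mid \neg\varphi\mid\varphi\wedge\varphi\mid\exists x.\varphi\mid\exists^{\alpha}X.\varphi$,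 with $a\in AP$, $x,y$ first-order variables, $X$ second-order variables. Over $(T,\mathrm{Lab})$, first-order variables range over nodes of $T$; $P_a(x)$ holds iff $a\in\mathrm{Lab}(x)$; $x\le y$ holds iff $y$ is a descendant of $x$ in $T$; $x\in X$ is membership; Boolean connectives and $\exists x$ are standard. The range of second-order quantification determines the logic: in MSO all subsets of $T$; in WMSO all finite subsets of $T$; in MTL (monadic tree logic) all subtrees of $T$; in WMTL all finite subtrees of $T$. A logic consists of its sentences (formulas without free variables). Expressiveness. Over a class of Kripke trees, two sentences over the same $AP$ are equivalent if they are satisfied by the same members (over $AP$) of the class. $L\le L'$ means that, for every finite $AP$, each $L$-sentence over $AP$ has an equivalent $L'$-sentence over $AP$. $L<L'$ means $L\le L'$ and $L'\not\le L$. $L\not\sim L'$ (incomparable) means $L\not\le L'$ and $L'\not\le L$. -}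

module Defs where

open import Data.Fin using (Fin)
open import Data.Fin.Subset using (Subset) renaming (_∈_ to _∈ˢ_)
open import Data.List using (List; _∷ʳ_; _++_)
open import Data.List.Membership.Propositional using () renaming (_∈_ to _∈ˡ_)
open import Data.List.Relation.Binary.Prefix.Heterogeneous using (Prefix)
open import Data.Nat using (ℕ; suc)
open import Data.Product using (Σ; ∃-syntax; _×_; proj₁; proj₂)
open import Data.Vec using (Vec; []; _∷_; lookup)
open import Function.Bundles using (_⇔_)
open import Level using (Lift; 0ℓ)
open import Relation.Binary.PropositionalEquality using (_≡_)
open import Relation.Nullary using (¬_)
open import Relation.Unary using (Pred; U; _∈_; _⊆_; _≐_)

Word : Set
Word = List ℕ

WordSet : Set₁
WordSet = Pred Word 0ℓ

infix 4 _≼_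

-- σ ≼ τ : τ has the form σ ++ σ′, i.e. σ is a prefix of τ.
_≼_ : Word → Word → Set
_≼_ = Prefix _≡_

IsTree : WordSet → Set
IsTree T =
  ∃[ τ₀ ] τ₀ ∈ T
        × (∀ {τ} → τ ∈ T → τ₀ ≼ τ)
        × (∀ {τ τ′} → τ₀ ++ τ ∈ T → τ′ ≼ τ → τ₀ ++ τ′ ∈ T)

Children : WordSet → Word → WordSet
Children T τ τ′ = τ′ ∈ T × ∃[ n ] τ′ ≡ τ ∷ʳ n

Finite : WordSet → Set
Finite X = ∃[ τs ] X ≐ (_∈ˡ τs)

NonBlocking : WordSet → Set
NonBlocking T = ∀ {τ} → τ ∈ T → ∃[ τ′ ] τ′ ∈ Children T τ

FinitelyBranching : WordSet → Set
FinitelyBranching T = ∀ {τ} → τ ∈ T → Finite (Children T τ)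

-- Kripke trees over AP = Fin n.  The membership argument of `label` is
-- irrelevant, so that a label depends on the node only and not on the
-- proof that it belongs to the tree.
record KripkeTree (n : ℕ) : Set₁ where
  field
    tree        : WordSet
    isTree      : IsTree tree
    nonBlocking : NonBlocking tree
    label       : ∀ τ → .(τ ∈ tree) → Subset n

  Node : Set
  Node = Σ Word tree

open KripkeTree public

Class : Set₁
Class = ∀ n → Pred (KripkeTree n) 0ℓ

AllKripkeTrees : Class
AllKripkeTrees n = U

FinitelyBranchingKripkeTrees : Class
FinitelyBranchingKripkeTrees n K = FinitelyBranching (tree K)

data Logic : Set where
  MSO WMSO MTL WMTL : Logic

Range : Logic → WordSet → Pred WordSet 0ℓ
Range MSO  T X = X ⊆ T
Range WMSO T X = X ⊆ T × Finite X
Range MTL  T X = X ⊆ T × IsTree X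
Range WMTL T X = X ⊆ T × IsTree X × Finite X

infix  7 _≤̇_ _∈̇_
infix  6 ¬̇_
infixr 5 _∧̇_
infix  4 ∃₁̇_ ∃₂̇_

-- Formula L n p q: formulas of L over AP = Fin n with p first-order and
-- q second-order variables in scope, as de Bruijn indices; each kind of
-- quantifier binds index 0 of its own sort.
data Formula (L : Logic) (n : ℕ) : (p q : ℕ) → Set where
  P    : ∀ {p q} → Fin n → Fin p → Formula L n p q
  _≤̇_  : ∀ {p q} → Fin p → Fin p → Formula L n p q
  _∈̇_  : ∀ {p q} → Fin p → Fin q → Formula L n p q
  ¬̇_   : ∀ {p q} → Formula L n p q → Formula L n p q
  _∧̇_  : ∀ {p q} → Formula L n p q → Formula L n p q → Formula L n p q
  ∃₁̇_  : ∀ {p q} → Formula L n (suc p) q → Formula L n p q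
  ∃₂̇_  : ∀ {p q} → Formula L n p (suc q) → Formula L n p q

Sentence : Logic → ℕ → Set
Sentence L n = Formula L n 0 0

module _ {L : Logic} {n : ℕ} (K : KripkeTree n) where

  Sat : ∀ {p q} → Vec (Node K) p → Vec WordSet q → Formula L n p q → Set₁
  Sat xs Xs (P a x)  = Lift _ (a ∈ˢ label K (proj₁ τ) (proj₂ τ))
    where τ = lookup xs x
  Sat xs Xs (x ≤̇ y)  = Lift _ (proj₁ (lookup xs x) ≼ proj₁ (lookup xs y))
  Sat xs Xs (x ∈̇ X)  = Lift _ (proj₁ (lookup xs x) ∈ lookup Xs X)
  Sat xs Xs (¬̇ φ)    = ¬ Sat xs Xs φ
  Sat xs Xs (φ ∧̇ ψ)  = Sat xs Xs φ × Sat xs Xs ψ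
  Sat xs Xs (∃₁̇ φ)   = ∃[ τ ] Sat (τ ∷ xs) Xs φ
  Sat xs Xs (∃₂̇ φ)   = ∃[ X ] X ∈ Range L (tree K) × Sat xs (X ∷ Xs) φ

infix 4 _⊨_

_⊨_ : ∀ {L n} → KripkeTree n → Sentence L n → Set₁
K ⊨ φ = Sat K [] [] φ

Equivalent : Class → ∀ {L L′ n} → Sentence L n → Sentence L′ n → Set₁
Equivalent C {n = n} φ ψ = ∀ (K : KripkeTree n) → K ∈ C n → K ⊨ φ ⇔ K ⊨ ψ

infix 4 _≤[_]_ _<[_]_ _≁[_]_

_≤[_]_ : Logic → Class → Logic → Set₁
L ≤[ C ] L′ = ∀ n (φ : Sentence L n) → ∃[ ψ ] Equivalent C {L} {L′} φ ψ

_<[_]_ : Logic → Class → Logic → Set₁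
L <[ C ] L′ = L ≤[ C ] L′ × ¬ (L′ ≤[ C ] L)

_≁[_]_ : Logic → Class → Logic → Set₁
L ≁[ C ] L′ = ¬ (L ≤[ C ] L′) × ¬ (L′ ≤[ C ] L)

{-# OPTIONS --safe #-}
-- Being a subtree is first-order definable, so MTL ≤ MSO and WMTL ≤ WMSO; over finitely-branching
-- trees finiteness of a set X is definable by a leafless set of nodes below each of which X has a
-- node (by König's argument the nodes with infinitely many descendants in X form one).  All the
-- rest follows from three non-inclusions.
--
-- * WMTL ≰ MSO over all trees.  "The root has finitely many children" is expressible in WMTL.  If
--   all the branches at the root are full trees, an MSO sentence only sees how many branches have
--   each of finitely many types, up to a threshold, and so confuses ω with a large finite number.
--
-- * MTL ≰ WMSO over finitely-branching trees, by diagonalisation.  The truth of a WMSO sentence ψ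
--   in a labelled binary tree unfolds into a well-founded game with countable choices.  This game
--   is laid out on the binary tree itself, its labels encoding the rules; an atom about the label
--   of w is decided only at positions longer than w, hence the labels may be chosen such that the
--   game for ¬ψ speaks about its own board.  MTL can say that a winning strategy exists, so it
--   holds there exactly when ψ fails.
--
-- * WMSO ≰ MTL over finitely-branching trees.  On a chain all subtrees are intervals, and MTL
--   becomes first-order logic, which cannot express that a marked node has even depth.
module Submission where

open import Defs
open import Axiom.ExcludedMiddle using (ExcludedMiddle)
open import Data.Bool using (Bool; true; false; not; if_then_else_; _≟_; _∧_)
open import Data.Bool.Properties using (¬-not; not-¬)
open import Data.Empty using (⊥)
open import Data.Fin using (Fin; zero; suc; toℕ; funToFin; finToFun)
open import Data.Fin.Properties using (finToFun-funToFin; toℕ<n; toℕ-injective)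
open import Data.Fin.Subset using (Subset) renaming (_∈_ to _∈ˢ_)
open import Data.List using (List; []; _∷_; _∷ʳ_; _++_; length; map; filter; replicate; foldl; upTo)
open import Data.List.Membership.Propositional using () renaming (_∈_ to _∈ˡ_)
open import Data.List.Membership.Propositional.Properties
  using (∈-filter⁺; ∈-filter⁻; ∈-++⁺ˡ; ∈-++⁺ʳ; ∈-map⁺; ∈-map⁻; ∈-upTo⁺)
open import Data.List.Properties
  using (++-identityʳ; ++-assoc; ++-cancelˡ; length-++; length-replicate; map-++; foldl-++;
         ∷-injective; ∷-injectiveˡ; ∷-injectiveʳ)
open import Data.List.Relation.Binary.Prefix.Heterogeneous using ([]; _∷_)
import Data.List.Relation.Binary.Prefix.Heterogeneous.Properties as PrefixP
open import Data.List.Relation.Unary.Any using (here; there)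
open import Data.Nat using (ℕ; zero; suc; nonZero; _+_; _*_; _∸_; _^_; _≤_; _<_; _<?_; z≤n; s≤s)
  renaming (_⊔_ to _⊔ₙ_; _≟_ to _≟ₙ_)
open import Data.Nat.ListAction using (sum)
open import Data.Nat.Properties
  using (*-comm; *-monoˡ-≤; +-assoc; +-cancelʳ-≤; +-cancelˡ-≤; +-comm; +-identityʳ; +-mono-≤;
         +-monoʳ-≤; +-monoˡ-≤; +-suc; <-irrefl; <⇒≢; <⇒≤; even≢odd; m+[n∸m]≡n; m+n∸n≡m; m∸n+n≡m;
         m≤m*n; m≤m+n; m≤m⊔n; m≤n+m; m≤n⊔m; n<1+n; n≤1+n; n≮0; ∸-monoˡ-≤; ≤-antisym; ≤-pred;
         ≤-refl; ≤-reflexive; ≤-total; ≤-trans; ≤⇒≯; ≤∧≢⇒<; ≮⇒≥; ≰⇒>; ≰⇒≥)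
open import Data.Product using (Σ; Σ-syntax; ∃-syntax; _×_; _,_; proj₁; proj₂; map₂) renaming (map to map×)
open import Data.Product.Function.NonDependent.Propositional using (_×-⇔_)
open import Data.Sum using (_⊎_; inj₁; inj₂; [_,_])
open import Data.Unit using (⊤; tt)
open import Data.Vec using (Vec; []; _∷_; lookup; tabulate) renaming (map to mapᵛ)
open import Data.Vec.Functional using () renaming (_∷_ to _∷ᶠ_)
open import Data.Vec.Properties using (lookup∘tabulate; lookup-map; []=⇒lookup; lookup⇒[]=)
open import Function using (_∘_; id)
open import Function.Bundles using (_⇔_; mk⇔; Equivalence)
open import Level using (lift; lower; 0ℓ; _⊔_) renaming (suc to lsuc)
open import Relation.Binary.PropositionalEquality
  using (_≡_; _≢_; refl; sym; trans; cong; cong₂; subst; subst₂; module ≡-Reasoning)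
open import Relation.Nullary using (¬_; Dec; yes; no; contradiction; does)
open import Relation.Nullary.Decidable using (decidable-stable; dec-true; dec-false)
open import Relation.Unary using (Pred; U; _∈_; _⊆_; _≐_; _∪_)

open Equivalence using (to; from)

-- Definability

infixr 5 _⇒̇_
_⇒̇_ : ∀ {L n p q} → Formula L n p q → Formula L n p q → Formula L n p q
φ ⇒̇ ψ = ¬̇ (φ ∧̇ ¬̇ ψ)

infix 4 ∀₁̇_ ∀₂̇_
∀₁̇_ : ∀ {L n p q} → Formula L n (suc p) q → Formula L n p q
∀₁̇ φ = ¬̇ (∃₁̇ ¬̇ φ)

∀₂̇_ : ∀ {L n p q} → Formula L n p (suc q) → Formula L n p q
∀₂̇ φ = ¬̇ (∃₂̇ ¬̇ φ)

-- A record rather than a bare _⇔_, so that φ is inferable: Sat computes on φ.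
record Means {L n} (K : KripkeTree n) {p q} (xs : Vec (Node K) p) (Xs : Vec WordSet q)
             (φ : Formula L n p q) {a} (A : Set a) : Set (lsuc 0ℓ ⊔ a) where
  constructor means
  field
    sound   : Sat K xs Xs φ → A
    complete : A → Sat K xs Xs φ

open Means

module _ {L : Logic} {n p q : ℕ} {K : KripkeTree n} {xs : Vec (Node K) p} {Xs : Vec WordSet q} where

  means-P : ∀ {a x} → let τ = lookup xs x in
            Means K xs Xs (P {L} a x) (a ∈ˢ label K (proj₁ τ) (proj₂ τ))
  means-P = means lower lift

  means-≤ : ∀ {x y} → Means K xs Xs (_≤̇_ {L} x y) (proj₁ (lookup xs x) ≼ proj₁ (lookup xs y))
  means-≤ = means lower lift

  means-∈ : ∀ {x X} → Means K xs Xs (_∈̇_ {L} x X) (proj₁ (lookup xs x) ∈ lookup Xs X)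
  means-∈ = means lower lift

  means-¬ : ∀ {a} {A : Set a} {φ : Formula L n p q} → Means K xs Xs φ A → Means K xs Xs (¬̇ φ) (¬ A)
  means-¬ m = means (_∘ complete m) (_∘ sound m)

  module _ {a b} {A : Set a} {B : Set b} {φ ψ : Formula L n p q} where

    means-∧ : Means K xs Xs φ A → Means K xs Xs ψ B → Means K xs Xs (φ ∧̇ ψ) (A × B)
    means-∧ m o = means (map× (sound m) (sound o)) (map× (complete m) (complete o))

  module _ {a} {A : Node K → Set a} {φ : Formula L n (suc p) q} where

    means-∃₁ : (∀ τ → Means K (τ ∷ xs) Xs φ (A τ)) → Means K xs Xs (∃₁̇ φ) (∃[ τ ] A τ)
    means-∃₁ m = means (map₂ (sound (m _))) (map₂ (complete (m _)))

  module _ {a} {A : WordSet → Set a} {φ : Formula L n p (suc q)} where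

    means-∃₂ : (∀ X → Means K xs (X ∷ Xs) φ (A X)) →
               Means K xs Xs (∃₂̇ φ) (∃[ X ] X ∈ Range L (tree K) × A X)
    means-∃₂ m = means (map₂ (map₂ (sound (m _)))) (map₂ (map₂ (complete (m _))))

infix 7 _<̇_
_<̇_ : ∀ {L n p q} → Fin p → Fin p → Formula L n p q
x <̇ y = x ≤̇ y ∧̇ ¬̇ y ≤̇ x

infix 4 _≺_
_≺_ : Word → Word → Set
u ≺ v = u ≼ v × ¬ v ≼ u

means-< : ∀ {L n} {K : KripkeTree n} {p q} {xs : Vec (Node K) p} {Xs : Vec WordSet q} {x y} →
          Means K xs Xs (_<̇_ {L} x y) (proj₁ (lookup xs x) ≺ proj₁ (lookup xs y))
means-< = means-∧ means-≤ (means-¬ means-≤)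

-- The prefix order and the nodes of a tree.

≼-refl : ∀ {w} → w ≼ w
≼-refl {[]}    = []
≼-refl {_ ∷ _} = refl ∷ ≼-refl

≼-trans : ∀ {u v w} → u ≼ v → v ≼ w → u ≼ w
≼-trans = PrefixP.trans trans

≼-++ : ∀ u v → u ≼ u ++ v
≼-++ []      v = []
≼-++ (_ ∷ u) v = refl ∷ ≼-++ u v

≼-suffix : ∀ {u w} → u ≼ w → ∃[ v ] w ≡ u ++ v
≼-suffix []         = _ , refl
≼-suffix (refl ∷ p) = map₂ (cong (_ ∷_)) (≼-suffix p)

≼-++ˡ : ∀ w {u v} → u ≼ v → w ++ u ≼ w ++ v
≼-++ˡ []      p = p
≼-++ˡ (_ ∷ w) p = refl ∷ ≼-++ˡ w p

≼-++ˡ⁻ : ∀ w {u v} → w ++ u ≼ w ++ v → u ≼ v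
≼-++ˡ⁻ []      p       = p
≼-++ˡ⁻ (_ ∷ w) (_ ∷ p) = ≼-++ˡ⁻ w p

≼-length : ∀ {u v} → u ≼ v → length u ≤ length v
≼-length = PrefixP.length-mono

≺-suffix : ∀ {u w} → u ≺ w → ∃[ a ] ∃[ v ] w ≡ u ++ a ∷ v
≺-suffix {u} (p , ¬q) with ≼-suffix p
... | []    , refl = contradiction (subst (_≼ u) (sym (++-identityʳ u)) ≼-refl) ¬q
... | a ∷ v , e    = a , v , e

suffix-≺ : ∀ u a v → u ≺ u ++ a ∷ v
suffix-≺ u a v = ≼-++ u _ , λ q → aux (≼-++ˡ⁻ u {a ∷ v} {[]} (subst (u ++ a ∷ v ≼_) (sym (++-identityʳ u)) q))
  where
  aux : ¬ a ∷ v ≼ []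
  aux ()

≺-length : ∀ {u v} → u ≺ v → length u < length v
≺-length {u} u≺v with a , v , refl ← ≺-suffix u≺v =
  subst (suc (length u) ≤_) (sym (trans (length-++ u) (+-suc (length u) (length v)))) (s≤s (m≤m+n _ _))

tree-≼-closed : ∀ {T} (t : IsTree T) {u v} → v ∈ T → proj₁ t ≼ u → u ≼ v → u ∈ T
tree-≼-closed {T} (τ₀ , _ , _ , closed) v∈T τ₀≼u u≼v
  with s , refl ← ≼-suffix τ₀≼u with r , refl ← ≼-suffix u≼v =
  closed (subst T (++-assoc τ₀ s r) v∈T) (≼-++ s r)

-- Lets `IsTree`, which speaks of words, be restated with quantifiers over nodes: a word between two
-- elements of X is itself a node.
node-closed : ∀ {n} (K : KripkeTree n) {X : WordSet} → X ⊆ tree K → ∀ {τ₀} → τ₀ ∈ X → ∀ {τ τ′} →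
              τ₀ ++ τ ∈ X → τ′ ≼ τ → τ₀ ++ τ′ ∈ tree K
node-closed K X⊆T τ₀∈X {τ} {τ′} τ∈X p =
  tree-≼-closed (isTree K) (X⊆T τ∈X)
    (≼-trans (proj₁ (proj₂ (proj₂ (isTree K))) (X⊆T τ₀∈X)) (≼-++ _ τ′)) (≼-++ˡ _ p)

-- Relativisation of set quantifiers.

module _ {L L′ : Logic} {n : ℕ} (δ : ∀ {p q} → Formula L′ n p (suc q)) where

  -- Every quantified set is guarded by δ, which has to carve the range of L out of the range of L′.
  relativise : ∀ {p q} → Formula L n p q → Formula L′ n p q
  relativise (P a x)  = P a x
  relativise (x ≤̇ y)  = x ≤̇ y
  relativise (x ∈̇ X)  = x ∈̇ X
  relativise (¬̇ φ)    = ¬̇ relativise φ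
  relativise (φ ∧̇ ψ)  = relativise φ ∧̇ relativise ψ
  relativise (∃₁̇ φ)   = ∃₁̇ relativise φ
  relativise (∃₂̇ φ)   = ∃₂̇ δ ∧̇ relativise φ

  module _ (K : KripkeTree n)
           (δ-range : ∀ {p q} (xs : Vec (Node K) p) (Xs : Vec WordSet q) X →
                      (X ∈ Range L (tree K)) ⇔ (X ∈ Range L′ (tree K) × Sat K xs (X ∷ Xs) δ)) where

    relativise-sat : ∀ {p q} (xs : Vec (Node K) p) (Xs : Vec WordSet q) (φ : Formula L n p q) →
                     Sat K xs Xs φ ⇔ Sat K xs Xs (relativise φ)
    relativise-sat xs Xs (P a x) = mk⇔ id id
    relativise-sat xs Xs (x ≤̇ y) = mk⇔ id id
    relativise-sat xs Xs (x ∈̇ X) = mk⇔ id id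
    relativise-sat xs Xs (¬̇ φ)   = mk⇔ (_∘ from (relativise-sat xs Xs φ)) (_∘ to (relativise-sat xs Xs φ))
    relativise-sat xs Xs (φ ∧̇ ψ) = relativise-sat xs Xs φ ×-⇔ relativise-sat xs Xs ψ
    relativise-sat xs Xs (∃₁̇ φ)  =
      mk⇔ (map₂ (to (relativise-sat _ Xs φ)))
          (map₂ (from (relativise-sat _ Xs φ)))
    relativise-sat xs Xs (∃₂̇ φ)  =
      mk⇔ (λ (X , r , s) → let r′ , d = to (δ-range xs Xs X) r in
             X , r′ , d , to (relativise-sat xs _ φ) s)
          (λ (X , r , d , s) → X , from (δ-range xs Xs X) (r , d) ,
             from (relativise-sat xs _ φ) s)

≤-by-relativising :
  ∀ {L L′} {C : Class} (δ : ∀ {n p q} → Formula L′ n p (suc q)) →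
  (∀ {n} (K : KripkeTree n) → K ∈ C n → ∀ {p q} (xs : Vec (Node K) p) (Xs : Vec WordSet q) X →
     (X ∈ Range L (tree K)) ⇔ (X ∈ Range L′ (tree K) × Sat K xs (X ∷ Xs) δ)) →
  L ≤[ C ] L′
≤-by-relativising δ δ-range n φ =
  relativise δ φ , λ K K∈C → relativise-sat δ K (δ-range K K∈C) [] [] φ

≤-trans-logic : ∀ {C L₁ L₂ L₃} → L₁ ≤[ C ] L₂ → L₂ ≤[ C ] L₃ → L₁ ≤[ C ] L₃
≤-trans-logic le₁ le₂ n φ =
  let ψ , φ~ψ = le₁ n φ ; χ , ψ~χ = le₂ n ψ in
  χ , λ K K∈C → mk⇔ (to (ψ~χ K K∈C) ∘ to (φ~ψ K K∈C))
                    (from (φ~ψ K K∈C) ∘ from (ψ~χ K K∈C))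

≤-restrict : ∀ {C L L′} → L ≤[ AllKripkeTrees ] L′ → L ≤[ C ] L′
≤-restrict le n φ = map₂ (λ eq K _ → eq K tt) (le n φ)

treeFormula : ∀ {L n p q} → Formula L n p (suc q)
treeFormula =
  ∃₁̇ zero ∈̇ zero
  ∧̇ (∀₁̇ zero ∈̇ zero ⇒̇ suc zero ≤̇ zero)
  ∧̇ (∀₁̇ ∀₁̇ suc zero ∈̇ zero ⇒̇ suc (suc zero) ≤̇ zero ⇒̇ zero ≤̇ suc zero ⇒̇ zero ∈̇ zero)

module _ {n} (K : KripkeTree n) where

  TreeMeaning : WordSet → Set
  TreeMeaning X = Σ[ (τ₀ , _) ∈ Node K ] τ₀ ∈ X
    × (((y , _) : Node K) → y ∈ X → τ₀ ≼ y)
    × (((y , _) (z , _) : Node K) → y ∈ X → τ₀ ≼ z → z ≼ y → z ∈ X)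

  isTree⇔TreeMeaning : ∀ {X} → X ⊆ tree K → IsTree X ⇔ TreeMeaning X
  isTree⇔TreeMeaning X⊆T = mk⇔
    (λ t@(τ₀ , τ₀∈X , root , _) → (τ₀ , X⊆T τ₀∈X) , τ₀∈X , (λ _ → root) ,
       λ _ _ → tree-≼-closed t)
    (λ ((τ₀ , _) , τ₀∈X , root , closed) → τ₀ , τ₀∈X , (λ y∈X → root (_ , X⊆T y∈X) y∈X) ,
       λ {τ} {τ′} y∈X p → closed (_ , X⊆T y∈X) (_ , node-closed K X⊆T τ₀∈X {τ} {τ′} y∈X p)
                            y∈X (≼-++ _ _) (≼-++ˡ _ p))

finite-bounded : ∀ (f : Word → ℕ) {X : WordSet} → Finite X → ∃[ N ] ∀ {w} → w ∈ X → f w ≤ N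
finite-bounded f (τs , X⊆τs , _) = let N , bound = go τs in N , λ w∈X → bound (X⊆τs w∈X)
  where
  go : ∀ τs → ∃[ N ] ∀ {w} → w ∈ˡ τs → f w ≤ N
  go []       = 0 , λ ()
  go (τ ∷ τs) = let N , bound = go τs in f τ ⊔ₙ N ,
    λ { (here refl) → m≤m⊔n _ _ ; (there w∈) → ≤-trans (bound w∈) (m≤n⊔m (f τ) N) }

Above : WordSet → Word → WordSet
Above X x w = w ∈ X × x ≼ w

-- Denies that some nonempty leafless Π (set variable 0) has below each of its nodes a node of X
-- (set variable 1). Π may be an arbitrary set or a subtree, so the formula serves both MSO and MTL.
finiteFormula : ∀ {L n p q} → Formula L n p (suc q)
finiteFormula = ¬̇ (∃₂̇ (∃₁̇ zero ∈̇ zero) ∧̇ (∀₁̇ zero ∈̇ zero ⇒̇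
  (∃₁̇ zero ∈̇ zero ∧̇ suc zero <̇ zero)
  ∧̇ (∃₁̇ zero ∈̇ suc zero ∧̇ suc zero ≤̇ zero)))

module _ {n} (K : KripkeTree n) where

  Thick : WordSet → WordSet → Set
  Thick X Π = (Σ[ (x , _) ∈ Node K ] x ∈ Π)
    × (((x , _) : Node K) → x ∈ Π →
       (Σ[ (y , _) ∈ Node K ] y ∈ Π × x ≺ y) × (Σ[ (z , _) ∈ Node K ] z ∈ X × x ≼ z))

  -- Having no leaf, Π contains arbitrarily long words, and X has words at least as long below them;
  -- lengths in a finite set are bounded.
  thick⇒infinite : ∀ {X Π} → Thick X Π → ¬ Finite X
  thick⇒infinite {X} {Π} (x₀ , thick) fin =
    let N , bound = finite-bounded length fin
        x , x∈Π , N<x = deep (suc N)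
        (z , _) , z∈X , x≼z = proj₂ (thick x x∈Π)
    in <-irrefl refl (≤-trans N<x (≤-trans (≼-length x≼z) (bound z∈X)))
    where
    deep : ∀ k → ∃[ x ] (proj₁ x ∈ Π × k ≤ length (proj₁ x))
    deep zero    = proj₁ x₀ , proj₂ x₀ , z≤n
    deep (suc k) =
      let x , x∈Π , k≤x = deep k ; y , y∈Π , x≺y = proj₁ (thick x x∈Π)
      in y , y∈Π , ≤-trans (s≤s k≤x) (≺-length x≺y)

  Unbounded : WordSet → WordSet
  Unbounded X x = x ∈ tree K × ¬ Finite (Above X x)

-- Thresholds and finitely many branch types

infixl 6 _∖_ _∖∖_
_∖_ : Pred ℕ 0ℓ → ℕ → Pred ℕ 0ℓ
(A ∖ x) y = A y × y ≢ x

_∖∖_ : Pred ℕ 0ℓ → Pred ℕ 0ℓ → Pred ℕ 0ℓ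
(A ∖∖ B) y = A y × ¬ B y

Fibre : Pred ℕ 0ℓ → (ℕ → ℕ) → ℕ → Pred ℕ 0ℓ
Fibre A f t x = A x × f x ≡ t

-- Cardinality is counted by choosing and removing elements, which treats finite and infinite sets
-- alike.
AtLeast : ℕ → Pred ℕ 0ℓ → Set
AtLeast zero    A = ⊤
AtLeast (suc n) A = ∃[ x ] A x × AtLeast n (A ∖ x)

Exactly : ℕ → Pred ℕ 0ℓ → Set
Exactly n A = AtLeast n A × ¬ AtLeast (suc n) A

atLeast-⊆ : ∀ n {A B : Pred ℕ 0ℓ} → A ⊆ B → AtLeast n A → AtLeast n B
atLeast-⊆ zero    A⊆B _             = tt
atLeast-⊆ (suc n) A⊆B (x , x∈ , al) = x , A⊆B x∈ , atLeast-⊆ n (map× A⊆B id) al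

atLeast-≤ : ∀ {m n A} → m ≤ n → AtLeast n A → AtLeast m A
atLeast-≤ z≤n       _             = tt
atLeast-≤ (s≤s m≤n) (x , x∈ , al) = x , x∈ , atLeast-≤ m≤n al

atLeast-∪ : ∀ a {b A B} → (∀ {x} → A x → ¬ B x) → AtLeast a A → AtLeast b B → AtLeast (a + b) (A ∪ B)
atLeast-∪ zero    {b} disj _             al′ = atLeast-⊆ b inj₂ al′
atLeast-∪ (suc a) {b} disj (x , x∈ , al) al′ = x , inj₁ x∈ ,
  atLeast-⊆ (a + b)
    (λ { (inj₁ (y∈ , y≢x)) → inj₁ y∈ , y≢x ; (inj₂ y∈) → inj₂ y∈ , λ { refl → disj x∈ y∈ } })
    (atLeast-∪ a (disj ∘ proj₁) al al′)

atLeast-∪⁻ : ∀ n {A B} → AtLeast n (A ∪ B) → ∃[ a ] ∃[ b ] (a + b ≡ n × AtLeast a A × AtLeast b B)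
atLeast-∪⁻ zero    _ = 0 , 0 , refl , tt , tt
atLeast-∪⁻ (suc n) {A} {B} (x , x∈ , al)
  with a , b , a+b≡n , alP , alQ ← atLeast-∪⁻ n {A ∖ x} {B ∖ x}
         (atLeast-⊆ n (λ { (inj₁ y∈ , y≢x) → inj₁ (y∈ , y≢x) ; (inj₂ y∈ , y≢x) → inj₂ (y∈ , y≢x) }) al)
  with x∈
... | inj₁ x∈A = suc a , b , cong suc a+b≡n , (x , x∈A , alP) , atLeast-⊆ b proj₁ alQ
... | inj₂ x∈B = a , suc b , trans (+-suc a b) (cong suc a+b≡n) , atLeast-⊆ a proj₁ alP , (x , x∈B , alQ)

atLeast-∖ : ∀ n {A} x → AtLeast (suc n) A → AtLeast n (A ∖ x)
atLeast-∖ zero    x _ = tt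
atLeast-∖ (suc n) x (y , y∈ , al) with y ≟ₙ x
... | yes refl = al
... | no y≢x   = y , (y∈ , y≢x) ,
  atLeast-⊆ n (λ ((z∈ , z≢y) , z≢x) → (z∈ , z≢x) , z≢y) (atLeast-∖ n x al)

atLeast-< : ∀ n → AtLeast n (_< n)
atLeast-< zero    = tt
atLeast-< (suc n) = n , ≤-refl , atLeast-⊆ n (λ x<n → ≤-trans x<n (n≤1+n n) , <⇒≢ x<n) (atLeast-< n)

-- B₀ gathers the first a elements chosen by the witness; the b others survive its removal.
split-off : ∀ a {b B} → AtLeast (a + b) B → ∃[ B₀ ] (B₀ ⊆ B × Exactly a B₀ × AtLeast b (B ∖∖ B₀))
split-off zero    {b} al = (λ _ → ⊥) , (λ ()) , (tt , λ ()) , atLeast-⊆ b (λ y∈ → y∈ , λ ()) al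
split-off (suc a) {b} {B} (x , x∈ , al)
  with B₀ , B₀⊆ , (alQ₀ , ¬alQ₀) , al′ ← split-off a {b} {B ∖ x} al =
  B₀ ∪ (_≡ x) , (λ { (inj₁ y∈) → proj₁ (B₀⊆ y∈) ; (inj₂ refl) → x∈ }) ,
  ((x , inj₂ refl , atLeast-⊆ a (λ y∈ → inj₁ y∈ , proj₂ (B₀⊆ y∈)) alQ₀) ,
   λ al″ → ¬alQ₀ (atLeast-⊆ (suc a) (λ { (inj₁ y∈ , _) → y∈ ; (inj₂ refl , x≢x) → contradiction refl x≢x })
                    (atLeast-∖ (suc a) x al″))) ,
  atLeast-⊆ b (λ ((y∈ , y≢x) , y∉) → y∈ , λ { (inj₁ y∈′) → y∉ y∈′ ; (inj₂ y≡x) → y≢x y≡x }) al′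

-- The cardinalities agree, or both are at least N.
record Equinumerous (N : ℕ) (A B : Pred ℕ 0ℓ) : Set where
  constructor equinumerous
  field
    counts : ∀ n → n ≤ N → AtLeast n A ⇔ AtLeast n B

open Equinumerous

module _ {N : ℕ} where

  equinumerous-sym : ∀ {A B} → Equinumerous N A B → Equinumerous N B A
  equinumerous-sym e = equinumerous λ n n≤ → mk⇔ (from (counts e n n≤)) (to (counts e n n≤))

  equinumerous-≐ : ∀ {A A′ B B′} → A ≐ A′ → B ≐ B′ → Equinumerous N A B → Equinumerous N A′ B′
  equinumerous-≐ (A⊆ , ⊆A) (B⊆ , ⊆B) e = equinumerous λ n n≤ → mk⇔
    (atLeast-⊆ n B⊆ ∘ to (counts e n n≤) ∘ atLeast-⊆ n ⊆A)
    (atLeast-⊆ n A⊆ ∘ from (counts e n n≤) ∘ atLeast-⊆ n ⊆B)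

  equinumerous-many : ∀ {A B} → AtLeast N A → AtLeast N B → Equinumerous N A B
  equinumerous-many alP alQ = equinumerous λ n n≤ → mk⇔ (λ _ → atLeast-≤ n≤ alQ) (λ _ → atLeast-≤ n≤ alP)

  equinumerous-exact : ∀ {m A B} → Exactly m A → Exactly m B → Equinumerous N A B
  equinumerous-exact {m} (alP , ¬alP) (alQ , ¬alQ) = equinumerous λ n _ → mk⇔ (go n alQ ¬alP) (go n alP ¬alQ)
    where
    go : ∀ n {A B} → AtLeast m B → ¬ AtLeast (suc m) A → AtLeast n A → AtLeast n B
    go n alQ ¬alP al = atLeast-≤ (≮⇒≥ λ m<n → ¬alP (atLeast-≤ m<n al)) alQ

  equinumerous-empty : ∀ {A B} → (∀ x → ¬ A x) → (∀ x → ¬ B x) → Equinumerous N A B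
  equinumerous-empty ¬A ¬B = equinumerous-exact {0} (tt , λ (x , x∈ , _) → ¬A x x∈) (tt , λ (x , x∈ , _) → ¬B x x∈)

  equinumerous-∪ : ∀ {A A′ B B′} → (∀ {x} → A x → ¬ A′ x) → (∀ {x} → B x → ¬ B′ x) →
                   Equinumerous N A B → Equinumerous N A′ B′ → Equinumerous N (A ∪ A′) (B ∪ B′)
  equinumerous-∪ dP dQ e e′ = equinumerous λ n n≤ → mk⇔
    (go dQ n n≤ (λ m m≤ → to (counts e m m≤)) (λ m m≤ → to (counts e′ m m≤)))
    (go dP n n≤ (λ m m≤ → from (counts e m m≤)) (λ m m≤ → from (counts e′ m m≤)))
    where
    go : ∀ {A A′ B B′} → (∀ {x} → B x → ¬ B′ x) → ∀ n → n ≤ N →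
         (∀ m → m ≤ N → AtLeast m A → AtLeast m B) → (∀ m → m ≤ N → AtLeast m A′ → AtLeast m B′) →
         AtLeast n (A ∪ A′) → AtLeast n (B ∪ B′)
    go dQ n n≤ f f′ al with a , b , refl , alP , alP′ ← atLeast-∪⁻ n al =
      atLeast-∪ a dQ (f a (≤-trans (m≤m+n a b) n≤) alP) (f′ b (≤-trans (m≤n+m b a) n≤) alP′)

  -- Induction on the number of classes: the top class is split off as a disjoint part.
  equinumerous-⋃ : ∀ H {A B : Pred ℕ 0ℓ} (h k : ℕ → ℕ) → (∀ {x} → A x → h x < H) → (∀ {x} → B x → k x < H) →
                   (∀ t → Equinumerous N (Fibre A h t) (Fibre B k t)) → Equinumerous N A B
  equinumerous-⋃ zero    h k h< k< e = equinumerous-empty (λ x x∈ → n≮0 (h< x∈)) (λ x x∈ → n≮0 (k< x∈))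
  equinumerous-⋃ (suc H) {A} {B} h k h< k< e =
    equinumerous-≐ (cover A h h<) (cover B k k<)
      (equinumerous-∪ (λ (_ , ≡H) (_ , ≢H) → ≢H ≡H) (λ (_ , ≡H) (_ , ≢H) → ≢H ≡H) (e H)
        (equinumerous-⋃ H h k (below A h h<) (below B k k<) rest))
    where
    Rest : Pred ℕ 0ℓ → (ℕ → ℕ) → Pred ℕ 0ℓ
    Rest A h x = A x × h x ≢ H
    cover : ∀ A h → (∀ {x} → A x → h x < suc H) → (Fibre A h H ∪ Rest A h) ≐ A
    cover A h h< = [ proj₁ , proj₁ ] , λ {x} x∈ → by (h x ≟ₙ H) x∈
      where
      by : ∀ {x} → Dec (h x ≡ H) → A x → (Fibre A h H ∪ Rest A h) x
      by (yes ≡H) x∈ = inj₁ (x∈ , ≡H)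
      by (no ≢H)  x∈ = inj₂ (x∈ , ≢H)
    below : ∀ A h → (∀ {x} → A x → h x < suc H) → ∀ {x} → Rest A h x → h x < H
    below A h h< (x∈ , ≢H) = ≤∧≢⇒< (≤-pred (h< x∈)) ≢H
    rest : ∀ t → Equinumerous N (Fibre (Rest A h) h t) (Fibre (Rest B k) k t)
    rest t with t ≟ₙ H
    ... | yes refl = equinumerous-empty (λ _ ((_ , ≢H) , ≡H) → ≢H ≡H) (λ _ ((_ , ≢H) , ≡H) → ≢H ≡H)
    ... | no t≢H   = equinumerous-≐ (restrict A h) (restrict B k) (e t)
      where
      restrict : ∀ A h → Fibre A h t ≐ Fibre (Rest A h) h t
      restrict A h = (λ { (x∈ , refl) → (x∈ , t≢H) , refl }) , λ ((x∈ , _) , ≡t) → x∈ , ≡t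

equinumerous-witness : ∀ {N A B} → 1 ≤ N → Equinumerous N A B → ∀ {x} → A x → ∃[ y ] B y
equinumerous-witness 1≤N e x∈ = let y , y∈ , _ = to (counts e 1 1≤N) (_ , x∈ , tt) in y , y∈

funToFin-injective : ∀ {m n} {f g : Fin m → Fin n} → funToFin f ≡ funToFin g → ∀ i → f i ≡ g i
funToFin-injective {f = f} {g} e i =
  trans (sym (finToFun-funToFin f i)) (trans (cong (λ k → finToFun k i) e) (finToFun-funToFin g i))

-- Atomic relations between sets; on singletons they express x ∈ X (and x = y) resp. x ≤ y.
Meets : WordSet → WordSet → Set
Meets X Y = ∃[ w ] w ∈ X × w ∈ Y

Reaches : WordSet → WordSet → Set
Reaches X Y = ∃[ v ] ∃[ w ] v ∈ X × w ∈ Y × v ≼ w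

Atom : Fin 2 → WordSet → WordSet → Set
Atom zero       = Meets
Atom (suc zero) = Reaches

-- A root with one branch for each i in D, every branch being the full tree of all words.
Bush : Pred ℕ 0ℓ → WordSet
Bush D []      = ⊤
Bush D (i ∷ w) = D i

bushTree : ∀ D → ∃[ i ] D i → KripkeTree 0
bushTree D _ .tree = Bush D
bushTree D _ .isTree = [] , tt , (λ _ → []) , closed
  where
  closed : ∀ {τ τ′} → τ ∈ Bush D → τ′ ≼ τ → τ′ ∈ Bush D
  closed τ∈ []         = tt
  closed τ∈ (refl ∷ _) = τ∈
bushTree D (i , i∈) .nonBlocking {[]}    _  = i ∷ [] , i∈ , i , refl
bushTree D _        .nonBlocking {j ∷ w} j∈ = j ∷ w ∷ʳ 0 , j∈ , 0 , refl
bushTree D _ .label _ _ = []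

branch : ∀ {m} → ℕ → Vec WordSet m → Vec WordSet m
branch i = mapᵛ λ X w → X (i ∷ w)

-- Rank 0 records two atomic relations for each ordered pair of the m sets; rank r + 1 records which
-- rank-r types of m + 1 sets arise by adding a set.
typeCount : ℕ → ℕ → ℕ
typeCount zero    m = ((2 ^ 2) ^ m) ^ m
typeCount (suc r) m = 2 ^ typeCount r (suc m)

-- The budget that `refine` consumes when a set is added: the next threshold for each finer type,
-- and one unit to tell empty from nonempty.
threshold : ℕ → ℕ → ℕ
threshold zero    m = 1
threshold (suc r) m = suc (typeCount r (suc m) * threshold r (suc m))

1≤threshold : ∀ r m → 1 ≤ threshold r m
1≤threshold zero    m = ≤-refl
1≤threshold (suc r) m = s≤s z≤n

-- A node quantifier counts for three set quantifiers: one for the singleton, and two for the test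
-- in `alike-singleton` that the answer is a singleton too.
rank : ∀ {p q} → Formula MSO 0 p q → ℕ
rank (P a x)  = 0
rank (x ≤̇ y)  = 0
rank (x ∈̇ X)  = 0
rank (¬̇ φ)    = rank φ
rank (φ ∧̇ ψ)  = rank φ ⊔ₙ rank ψ
rank (∃₁̇ φ)   = 3 + rank φ
rank (∃₂̇ φ)   = 1 + rank φ

-- Some finite subtree contains the root and all its children. These are the nodes without a proper
-- prefix z other than the root; z is not the root if some u is no descendant of z.
finiteRootFormula : Sentence WMTL 0
finiteRootFormula = ∃₂̇ ∀₁̇
  ¬̇ (∃₁̇ zero ≤̇ suc zero ∧̇ (∃₁̇ ¬̇ suc zero ≤̇ zero) ∧̇ ¬̇ suc zero ≤̇ zero) ⇒̇ zero ∈̇ zero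

module _ (K : KripkeTree 0) where

  -- y is neither the root nor one of its children.
  Deep : Word → Set
  Deep y = Σ[ (z , _) ∈ Node K ] z ≼ y × (Σ[ (u , _) ∈ Node K ] ¬ z ≼ u) × ¬ y ≼ z

  CoversTop : WordSet → Set
  CoversTop X = ((y , _) : Node K) → ¬ Deep y → y ∈ X

-- Games on the binary tree

-- Well-founded infinitary Boolean formulas: `lit a w b` claims that label a of w has value b,
-- `node true` is a countable disjunction and `node false` a countable conjunction.
data Code : Set where
  lit   : Fin 2 → List Bool → Bool → Code
  const : Bool → Code
  node  : Bool → (ℕ → Code) → Code

dual : Code → Code
dual (lit a w b) = lit a w (not b)
dual (const b)   = const (not b)
dual (node b f)  = node (not b) (dual ∘ f)

owner : Code → Bool
owner (lit a w b) = false
owner (const b)   = false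
owner (node b f)  = b

-- A choice among countably many options is made in unary by binary moves: `false` enters the first
-- option, `true` discards it.
step : Code → Bool → Code
step (lit a w b) d     = lit a w b
step (const b)   d     = const b
step (node b f)  false = f 0
step (node b f)  true  = node b (f ∘ suc)

run : Code → List Bool → Code
run = foldl step

dual-step : ∀ c d → dual (step c d) ≡ step (dual c) d
dual-step (lit a w b) d     = refl
dual-step (const b)   d     = refl
dual-step (node b f)  false = refl
dual-step (node b f)  true  = refl

dual-run : ∀ c u → dual (run c u) ≡ run (dual c) u
dual-run c []      = refl
dual-run c (d ∷ u) = trans (dual-run (step c d) u) (cong (λ e → run e u) (dual-step c d))

owner-dual : ∀ c → owner c ≡ true → owner (dual c) ≡ false
owner-dual (node true f) refl = refl

run-lit : ∀ a w b u → run (lit a w b) u ≡ lit a w b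
run-lit a w b []      = refl
run-lit a w b (_ ∷ u) = run-lit a w b u

run-const : ∀ b u → run (const b) u ≡ const b
run-const b []      = refl
run-const b (_ ∷ u) = run-const b u

record Leafless (Π : List Bool → Set) : Set where
  field
    nonEmpty : Π []
    closed   : ∀ u v → Π (u ++ v) → Π u
    extend   : ∀ u → Π u → ∃[ d ] Π (u ∷ʳ d)

open Leafless

below : ∀ {Π d} → Leafless Π → Π (d ∷ []) → Leafless (Π ∘ (d ∷_))
below l d∈ = record { nonEmpty = d∈ ; closed = λ u v → closed l (_ ∷ u) v ; extend = λ u → extend l (_ ∷ u) }

grow : ∀ {Π} → Leafless Π → ∀ n → ∃[ u ] (Π u × n ≤ length u)
grow l zero    = [] , nonEmpty l , z≤n
grow l (suc n) =
  let u , u∈ , n≤u = grow l n ; d , ud∈ = extend l u u∈ in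
  u ∷ʳ d , ud∈ , subst (suc n ≤_) (sym (trans (length-++ u) (+-comm (length u) 1))) (s≤s n≤u)

module _ (T : Fin 2 → List Bool → Bool) where

  Tr : Code → Set
  Tr (lit a w b)    = T a w ≡ b
  Tr (const b)      = b ≡ true
  Tr (node true f)  = ∃[ n ] Tr (f n)
  Tr (node false f) = ∀ n → Tr (f n)

  -- The winning side of a disjunction must take the first true disjunct; this rules out
  -- postponing the choice forever.
  Legal : Code → Bool → Set
  Legal (node true f) true = ¬ Tr (f 0)
  Legal _             _    = ⊤

  allow : ∀ c → owner c ≡ false → Tr c → ∀ d → Legal c d × Tr (step c d)
  allow (lit a w b)    _ t d     = tt , t
  allow (const b)      _ t d     = tt , t
  allow (node false f) _ t false = tt , t 0
  allow (node false f) _ t true  = tt , t ∘ suc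

  -- The positions reached while the verifier keeps the current code true and obeys `Legal`; moves
  -- at conjunctions are unrestricted.
  Strategy : Code → List Bool → Set
  Strategy c []      = Tr c
  Strategy c (d ∷ u) = Tr c × Legal c d × Strategy (step c d) u

  strategy-start : ∀ c u → Strategy c u → Tr c
  strategy-start c []      s = s
  strategy-start c (d ∷ u) s = proj₁ s

  strategy-closed : ∀ c u v → Strategy c (u ++ v) → Strategy c u
  strategy-closed c []      v s           = strategy-start c v s
  strategy-closed c (d ∷ u) v (t , l , s) = t , l , strategy-closed (step c d) u v s

  strategy-after : ∀ c u v → Strategy c (u ++ v) → Strategy (run c u) v
  strategy-after c []      v s           = s
  strategy-after c (d ∷ u) v (_ , _ , s) = strategy-after (step c d) u v s

  strategy-end : ∀ c u → Strategy c u → Tr (run c u)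
  strategy-end c []      s           = s
  strategy-end c (d ∷ u) (_ , _ , s) = strategy-end (step c d) u s

  strategy-extend : ∀ c u d → Strategy c u → Legal (run c u) d × Tr (step (run c u) d) →
                    Strategy c (u ∷ʳ d)
  strategy-extend c []      d s           (l′ , t′) = s , l′ , t′
  strategy-extend c (e ∷ u) d (t , l , s) lt        = t , l , strategy-extend (step c e) u d s lt

  -- The winning label. Staying forever at a conjunction is a win for the verifier, at a disjunction
  -- a loss; a literal about w is believed only at positions longer than w.
  glow : ℕ → Code → Bool
  glow l (lit a w b) = does (length w <? l) ∧ does (T a w ≟ b)
  glow l (const b)   = b
  glow l (node b f)  = not b

  Bright : ℕ → Code → Set
  Bright l (lit a w b) = length w < l × T a w ≡ b
  Bright l (const b)   = b ≡ true
  Bright l (node b f)  = b ≡ false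

  bright-glow : ∀ {l} c → Bright l c → glow l c ≡ true
  bright-glow {l} (lit a w b) (w<l , t)
    rewrite dec-true (length w <? l) w<l | dec-true (T a w ≟ b) t = refl
  bright-glow (const true)   refl = refl
  bright-glow (node false f) refl = refl

  -- A position bright for the dual code lacks the winning label of the original game; this is how
  -- the opponent's victory shows.
  bright-dual : ∀ {l} c → Bright l (dual c) → glow l c ≡ false
  bright-dual {l} (lit a w b) (w<l , t)
    rewrite dec-true (length w <? l) w<l | dec-false (T a w ≟ b) (λ t′ → not-¬ t′ t) = refl
  bright-dual (const false) refl = refl
  bright-dual (node true f) refl = refl

  -- The offset l is the depth on the board at which c starts, as the brightness of a literal
  -- depends on that depth.
  Settled : ℕ → (List Bool → Set) → Code → Set
  Settled l Π c = ∃[ u ] (Π u × ∀ v → Π (u ++ v) → Bright (l + length (u ++ v)) (run c (u ++ v)))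

  Settles : Code → Set₁
  Settles c = ∀ l (Π : List Bool → Set) → Leafless Π → (∀ u → Π u → Strategy c u) → Settled l Π c

  settled-step : ∀ c d {l Π} → Settled (suc l) (Π ∘ (d ∷_)) (step c d) → Settled l Π c
  settled-step c d {l} (u , u∈ , bright) =
    d ∷ u , u∈ , λ v v∈ → subst (λ m → Bright m (run (step c d) (u ++ v))) (sym (+-suc l _)) (bright v v∈)

  settles-below : ∀ c d → Settles (step c d) →
    ∀ l (Π : List Bool → Set) → Leafless Π → (∀ u → Π u → Strategy c u) → Π (d ∷ []) → Settled l Π c
  settles-below c d settles l Π lf strat d∈ = settled-step c d
    (settles (suc l) (Π ∘ (d ∷_)) (below lf d∈) (λ u u∈ → proj₂ (proj₂ (strat (d ∷ u) u∈))))

  -- Induction on the index n of a true option: `Legal` forbids discarding a true first option, so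
  -- an option is entered after at most n discards.
  settles-true : ∀ f → (∀ n → Settles (f n)) → ∀ n → Tr (f n) → Settles (node true f)
  settles-true f sₙ n t l Π lf strat with extend lf [] (nonEmpty lf)
  ... | false , d∈ = settles-below (node true f) false (sₙ 0) l Π lf strat d∈
  settles-true f sₙ zero    t l Π lf strat | true , d∈ = contradiction t (proj₁ (proj₂ (strat _ d∈)))
  settles-true f sₙ (suc n) t l Π lf strat | true , d∈ =
    settles-below (node true f) true (settles-true (f ∘ suc) (sₙ ∘ suc) n t) l Π lf strat d∈

  Exit : (List Bool → Set) → ℕ → Set
  Exit Π n = Π (replicate n true ∷ʳ false)

  -- `Settled` asks for one suitable position only, so it suffices to follow the single play that
  -- enters option n.
  settles-exit : ∀ n f → (∀ n → Settles (f n)) → ∀ l (Π : List Bool → Set) → Leafless Π →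
    (∀ u → Π u → Strategy (node false f) u) → Exit Π n → Settled l Π (node false f)
  settles-exit zero    f sₙ l Π lf strat exit = settles-below (node false f) false (sₙ 0) l Π lf strat exit
  settles-exit (suc n) f sₙ l Π lf strat exit = settled-step (node false f) true
    (settles-exit n (f ∘ suc) (sₙ ∘ suc) (suc l) (Π ∘ (true ∷_))
      (below lf (closed lf (true ∷ []) _ exit)) (λ u u∈ → proj₂ (proj₂ (strat (true ∷ u) u∈))) exit)

  -- A play that enters no option has only discarded some, so it is still at a conjunction.
  stays : ∀ f (Π : List Bool → Set) → (∀ u v → Π (u ++ v) → Π u) → (∀ n → ¬ Exit Π n) →
          ∀ l v → Π v → Bright l (run (node false f) v)
  stays f Π cl ¬exit l []          v∈ = refl
  stays f Π cl ¬exit l (false ∷ v) v∈ = contradiction (cl (false ∷ []) v v∈) (¬exit 0)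
  stays f Π cl ¬exit l (true ∷ v)  v∈ =
    stays (f ∘ suc) (Π ∘ (true ∷_)) (λ u → cl (true ∷ u)) (¬exit ∘ suc) l v v∈

-- The binary tree as a Kripke tree, and the game formula.

bit : Bool → ℕ
bit false = 0
bit true  = 1

toWord : List Bool → Word
toWord = map bit

fromWord : Word → List Bool
fromWord = map λ n → does (0 <? n)

from-to : ∀ u → fromWord (toWord u) ≡ u
from-to []          = refl
from-to (false ∷ u) = cong (false ∷_) (from-to u)
from-to (true ∷ u)  = cong (true ∷_) (from-to u)

toWord-∷ʳ : ∀ u d → toWord (u ∷ʳ d) ≡ toWord u ∷ʳ bit d
toWord-∷ʳ u d = map-++ bit u (d ∷ [])

toWord-≼ : ∀ u v → toWord u ≼ toWord (u ++ v)
toWord-≼ u v = subst (toWord u ≼_) (sym (map-++ bit u v)) (≼-++ _ _)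

toWord-++⁻ : ∀ u {v} s → toWord v ≡ toWord u ++ s → ∃[ r ] (v ≡ u ++ r × s ≡ toWord r)
toWord-++⁻ []          {v}         s e = v , refl , sym e
toWord-++⁻ (false ∷ u) {false ∷ v} s e = map₂ (map× (cong (false ∷_)) id) (toWord-++⁻ u s (∷-injectiveʳ e))
toWord-++⁻ (true ∷ u)  {true ∷ v}  s e = map₂ (map× (cong (true ∷_)) id) (toWord-++⁻ u s (∷-injectiveʳ e))

toWord-≼⁻ : ∀ u {v} → toWord u ≼ toWord v → ∃[ r ] v ≡ u ++ r
toWord-≼⁻ u p = let s , e = ≼-suffix p ; r , e′ , _ = toWord-++⁻ u s e in r , e′

toWord-prefix : ∀ {w} v → w ≼ toWord v → ∃[ u ] (w ≡ toWord u × ∃[ r ] v ≡ u ++ r)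
toWord-prefix []      []         = [] , refl , [] , refl
toWord-prefix (d ∷ v) []         = [] , refl , d ∷ v , refl
toWord-prefix (d ∷ v) (refl ∷ p) with u , refl , r , refl ← toWord-prefix v p = d ∷ u , refl , r , refl

Binary : WordSet
Binary w = ∃[ u ] w ≡ toWord u

image : (List Bool → Set) → WordSet
image Π w = ∃[ u ] (w ≡ toWord u × Π u)

image-∈⁻ : ∀ (Π : List Bool → Set) {u} → toWord u ∈ image Π → Π u
image-∈⁻ Π {u} (v , e , v∈) = subst Π (trans (sym (from-to v)) (trans (cong fromWord (sym e)) (from-to u))) v∈

image-isTree : ∀ (Π : List Bool → Set) r → Π r → (∀ {u} → Π u → toWord r ≼ toWord u) →
               (∀ u v → Π ((r ++ u) ++ v) → Π (r ++ u)) → IsTree (image Π)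
image-isTree Π r r∈ root closed = toWord r , (r , refl , r∈) , (λ { (u , refl , u∈) → root u∈ }) , cl
  where
  cl : ∀ {τ τ′} → toWord r ++ τ ∈ image Π → τ′ ≼ τ → toWord r ++ τ′ ∈ image Π
  cl {τ} (v , e , v∈) p with u , refl , refl ← toWord-++⁻ r {v} τ (sym e)
                         with s , refl , t , refl ← toWord-prefix u p =
    r ++ s , sym (map-++ bit r s) , closed s t (subst Π (sym (++-assoc r s t)) v∈)

binary-isTree : IsTree Binary
binary-isTree = [] , ([] , refl) , (λ _ → []) ,
  λ { (v , refl) p → let u , e , _ = toWord-prefix v p in u , e }

binaryTree : ∀ {n} → (Fin n → List Bool → Bool) → KripkeTree n
binaryTree T .tree = Binary
binaryTree T .isTree = binary-isTree
binaryTree T .nonBlocking (u , refl) = _ , (u ∷ʳ false , refl) , 0 , toWord-∷ʳ u false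
binaryTree T .label τ _ = tabulate λ a → T a (fromWord τ)

binary-label : ∀ {n} (T : Fin n → List Bool → Bool) a u .(u∈ : toWord u ∈ Binary) →
               (a ∈ˢ label (binaryTree T) (toWord u) u∈) ⇔ (T a u ≡ true)
binary-label T a u _ = mk⇔
  (λ a∈ → trans (sym value) ([]=⇒lookup a∈))
  (λ t → lookup⇒[]= a _ (trans value t))
  where
  value : lookup (tabulate λ a → T a (fromWord (toWord u))) a ≡ T a u
  value = trans (lookup∘tabulate _ a) (cong (T a) (from-to u))

-- A strategy S picks a successor of the nodes labelled 0 and keeps all successors of the others;
-- all plays in S have to meet the label 1, infinitely often since a tail of a play is leafless too.
gameFormula : Sentence MTL 2
gameFormula = ∃₂̇
  (∃₁̇ zero ∈̇ zero ∧̇ (∀₁̇ suc zero ≤̇ zero))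
  ∧̇ (∀₁̇ zero ∈̇ zero ⇒̇
       (P zero zero ⇒̇ (∃₁̇ zero ∈̇ zero ∧̇ suc zero <̇ zero))
       ∧̇ (¬̇ P zero zero ⇒̇ (∀₁̇ suc zero <̇ zero ⇒̇
            (∃₁̇ zero ∈̇ zero ∧̇ suc (suc zero) <̇ zero ∧̇ zero ≤̇ suc zero))))
  ∧̇ (∀₂̇ (∀₁̇ zero ∈̇ zero ⇒̇ zero ∈̇ suc zero ∧̇ (∃₁̇ zero ∈̇ zero ∧̇ suc zero <̇ zero)) ⇒̇
       (∃₁̇ zero ∈̇ zero ∧̇ P (suc zero) zero))

module _ (K : KripkeTree 2) where

  Labelled : Fin 2 → Node K → Set
  Labelled a (x , x∈T) = a ∈ˢ label K x x∈T

  Winning : WordSet → Set₁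
  Winning S =
    (Σ[ (x , _) ∈ Node K ] x ∈ S × (((y , _) : Node K) → x ≼ y))
    × ((τ@(x , _) : Node K) → x ∈ S →
         (Labelled zero τ → Σ[ (y , _) ∈ Node K ] y ∈ S × x ≺ y)
         × (¬ Labelled zero τ → ((y , _) : Node K) → x ≺ y →
              Σ[ (z , _) ∈ Node K ] z ∈ S × x ≺ z × z ≼ y))
    × (∀ Π → Π ∈ Range MTL (tree K) →
         (((x , _) : Node K) → x ∈ Π → x ∈ S × Σ[ (y , _) ∈ Node K ] y ∈ Π × x ≺ y) →
         Σ[ τ@(x , _) ∈ Node K ] x ∈ Π × Labelled (suc zero) τ)

toWord-≺⁻ : ∀ u {v} → toWord u ≺ toWord v → ∃[ d ] ∃[ t ] v ≡ (u ∷ʳ d) ++ t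
toWord-≺⁻ u {v} u≺v with ≺-suffix u≺v
... | a , s , e with toWord-++⁻ u {v} (a ∷ s) e
... | d ∷ t , e′ , _ = d , t , trans e′ (sym (++-assoc u (d ∷ []) t))

toWord-≺ : ∀ u d t → toWord u ≺ toWord ((u ∷ʳ d) ++ t)
toWord-≺ u d t = subst (toWord u ≺_)
  (sym (trans (cong toWord (++-assoc u (d ∷ []) t)) (map-++ bit u (d ∷ t))))
  (suffix-≺ (toWord u) (bit d) (toWord t))

module _ {X : WordSet} (t : IsTree X) where

  subtree-closed : ∀ u v → proj₁ t ≼ toWord u → toWord (u ++ v) ∈ X → toWord u ∈ X
  subtree-closed u v root≼u uv∈ = tree-≼-closed t uv∈ root≼u (toWord-≼ u v)

  subtree-child : ∀ u {v} → toWord u ∈ X → toWord v ∈ X → toWord u ≺ toWord v → ∃[ d ] toWord (u ∷ʳ d) ∈ X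
  subtree-child u {v} u∈ v∈ u≺v with toWord-≺⁻ u u≺v
  ... | d , s , refl = d , subtree-closed (u ∷ʳ d) s
    (≼-trans (proj₁ (proj₂ (proj₂ t)) u∈) (toWord-≼ u _)) v∈

guard : ∀ {m n x y} → (m < n → x ≡ y) → does (m <? n) ∧ x ≡ does (m <? n) ∧ y
guard {m} {n} {x} {y} x≡y = by (m <? n)
  where
  by : (m<n? : Dec (m < n)) → does m<n? ∧ x ≡ does m<n? ∧ y
  by (yes m<n) = x≡y m<n
  by (no _)    = refl

-- The labels of the game for c₀ whose literals refer to these very labels: a literal about w is
-- read only at positions longer than w, so the first argument (fuel) of labels is immaterial
-- once it exceeds the length of the position.
module SelfReference (c₀ : Code) where

  labels : ℕ → Fin 2 → List Bool → Bool
  goodLabel : ℕ → ℕ → Code → Bool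

  labels k zero       u = owner (run c₀ u)
  labels k (suc zero) u = goodLabel k (length u) (run c₀ u)

  goodLabel zero    l (lit a w b) = false
  goodLabel (suc k) l (lit a w b) = does (length w <? l) ∧ does (labels k a w ≟ b)
  goodLabel k       l (const b)   = b
  goodLabel k       l (node b f)  = not b

  labels-stable : ∀ k k′ a u → length u < k → length u < k′ → labels k a u ≡ labels k′ a u
  goodLabel-stable : ∀ k k′ l c → l < k → l < k′ → goodLabel k l c ≡ goodLabel k′ l c

  labels-stable k k′ zero       u _   _    = refl
  labels-stable k k′ (suc zero) u u<k u<k′ = goodLabel-stable k k′ (length u) (run c₀ u) u<k u<k′

  goodLabel-stable (suc k) (suc k′) l (lit a w b) (s≤s l≤k) (s≤s l≤k′) =
    guard λ w<l → cong (λ t → does (t ≟ b)) (labels-stable k k′ a w (≤-trans w<l l≤k) (≤-trans w<l l≤k′))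
  goodLabel-stable (suc k) (suc k′) l (const b)  _ _ = refl
  goodLabel-stable (suc k) (suc k′) l (node b f) _ _ = refl

  -- Fuel just above the length of the position; by `labels-stable` any larger amount gives the same
  -- label.
  T : Fin 2 → List Bool → Bool
  T a u = labels (suc (length u)) a u

  -- The fixed-point equation: the winning labels on the board are computed with the board itself
  -- interpreting the literals.
  T-glow : ∀ u → T (suc zero) u ≡ glow T (length u) (run c₀ u)
  T-glow u with run c₀ u
  ... | const b   = refl
  ... | node b f  = refl
  ... | lit a w b = guard λ w<u → cong (λ t → does (t ≟ b)) (labels-stable _ _ a w w<u (n<1+n _))

  K : KripkeTree 2
  K = binaryTree T

  owner-label : ∀ u .(u∈ : toWord u ∈ Binary) → (zero ∈ˢ label K (toWord u) u∈) ⇔ (owner (run c₀ u) ≡ true)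
  owner-label = binary-label T zero

-- Bijective base-2 numeration: the n-th binary word, least significant digit first.
increment : List Bool → List Bool
increment []          = false ∷ []
increment (false ∷ u) = true ∷ u
increment (true ∷ u)  = false ∷ increment u

enumWord : ℕ → List Bool
enumWord zero    = []
enumWord (suc n) = increment (enumWord n)

enumWord-odd : ∀ n → enumWord (suc (n * 2)) ≡ false ∷ enumWord n
enumWord-odd zero    = refl
enumWord-odd (suc n) = cong (increment ∘ increment) (enumWord-odd n)

enumWord-surjective : ∀ u → ∃[ n ] enumWord n ≡ u
enumWord-surjective []          = 0 , refl
enumWord-surjective (false ∷ u) = let n , e = enumWord-surjective u in
  suc (n * 2) , trans (enumWord-odd n) (cong (false ∷_) e)
enumWord-surjective (true ∷ u)  = let n , e = enumWord-surjective u in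
  suc (suc (n * 2)) , trans (cong increment (enumWord-odd n)) (cong (true ∷_) e)

onHead : (List Bool → List Bool) → List (List Bool) → List (List Bool)
onHead f []       = []
onHead f (w ∷ ws) = f w ∷ ws

-- In the code of a list of words, false announces a letter and true starts a new word.
parse : List Bool → List (List Bool)
parse []              = []
parse (true ∷ u)      = [] ∷ parse u
parse (false ∷ [])    = []
parse (false ∷ b ∷ u) = onHead (b ∷_) (parse u)

print : List Bool → List Bool → List Bool
print []      u = true ∷ u
print (b ∷ w) u = false ∷ b ∷ print w u

parse-print : ∀ w u → parse (print w u) ≡ w ∷ parse u
parse-print []      u = refl
parse-print (b ∷ w) u = cong (onHead (b ∷_)) (parse-print w u)

parse-surjective : ∀ ws → ∃[ u ] parse u ≡ ws
parse-surjective []       = [] , refl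
parse-surjective (w ∷ ws) = let u , e = parse-surjective ws in
  print w u , trans (parse-print w u) (cong (w ∷_) e)

enumWords : ℕ → List (List Bool)
enumWords = parse ∘ enumWord

enumWords-surjective : ∀ ws → ∃[ n ] enumWords n ≡ ws
enumWords-surjective ws =
  let u , e = parse-surjective ws ; n , e′ = enumWord-surjective u in n , trans (cong parse e′) e

-- A binary connective as a countable family: all indices from 1 on repeat the second member.
either : Code → Code → ℕ → Code
either c₁ c₂ zero    = c₁
either c₁ c₂ (suc _) = c₂

-- Intervals of a chain

zeros : ℕ → Word
zeros n = replicate n 0

zeros-≼ : ∀ {m n} → m ≤ n → zeros m ≼ zeros n
zeros-≼ z≤n       = []
zeros-≼ (s≤s m≤n) = refl ∷ zeros-≼ m≤n

Chain : WordSet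
Chain w = w ≡ zeros (length w)

zeros∈Chain : ∀ n → zeros n ∈ Chain
zeros∈Chain n = cong zeros (sym (length-replicate n))

chain-≼ : ∀ {u v} → u ∈ Chain → v ∈ Chain → length u ≤ length v → u ≼ v
chain-≼ u∈ v∈ p = subst₂ _≼_ (sym u∈) (sym v∈) (zeros-≼ p)

chain-prefix : ∀ {u v} → v ∈ Chain → u ≼ v → u ∈ Chain
chain-prefix                 v∈ []         = refl
chain-prefix {v = _ ∷ _} v∈ (refl ∷ p) =
  cong₂ _∷_ (∷-injectiveˡ v∈) (chain-prefix (∷-injectiveʳ v∈) p)

does-true : ∀ {a} {A : Set a} (a? : Dec A) → does a? ≡ true → A
does-true (yes a) _ = a

Marked : ℕ → Word → Subset 1
Marked N w = does (length w ≟ₙ N) ∷ []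

chainTree : ℕ → KripkeTree 1
chainTree N .tree = Chain
chainTree N .isTree = [] , refl , (λ _ → []) , chain-prefix
chainTree N .nonBlocking {τ} τ∈ = τ ∷ʳ 0 , subst (_∈ Chain) (sym eq) (zeros∈Chain (suc (length τ))) , 0 , refl
  where
  eq : τ ∷ʳ 0 ≡ zeros (suc (length τ))
  eq = trans (cong (_∷ʳ 0) τ∈) (snoc (length τ))
    where
    snoc : ∀ n → zeros n ∷ʳ 0 ≡ zeros (suc n)
    snoc zero    = refl
    snoc (suc n) = cong (0 ∷_) (snoc n)
chainTree N .label τ _ = Marked N τ

marked : ∀ N w → (zero ∈ˢ Marked N w) ⇔ (length w ≡ N)
marked N w = mk⇔ to′ from′
  where
  to′ : zero ∈ˢ Marked N w → length w ≡ N
  to′ z∈ = does-true (length w ≟ₙ N) ([]=⇒lookup z∈)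
  from′ : length w ≡ N → zero ∈ˢ Marked N w
  from′ e = lookup⇒[]= zero (Marked N w) (dec-true (length w ≟ₙ N) e)

-- The precision required before a quantifier to keep precision N after it: comparing through an
-- anchor adds two offsets up to N, and placing a far position uses a gap of 2(N + 1).
next : ℕ → ℕ
next N = suc N + suc N

n≤next : ∀ N → N ≤ next N
n≤next N = ≤-trans (n≤1+n N) (m≤m+n (suc N) (suc N))

-- Adding d and d′ on the two sides compares truncated differences without subtraction.
record Near (N : ℕ) {m} (v v′ : Vec ℕ m) : Set where
  constructor near
  field
    ordered : ∀ i j d d′ → d ≤ N → d′ ≤ N →
      d + lookup v i ≤ d′ + lookup v j → d + lookup v′ i ≤ d′ + lookup v′ j

open Near

Close : ℕ → ∀ {m} → Vec ℕ m → Vec ℕ m → Set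
Close N v v′ = Near N v v′ × Near N v′ v

near-mono : ∀ {M N m} {v v′ : Vec ℕ m} → M ≤ N → Near N v v′ → Near M v v′
near-mono M≤N n = near λ i j d d′ d≤ d′≤ → ordered n i j d d′ (≤-trans d≤ M≤N) (≤-trans d′≤ M≤N)

Compatible : ℕ → ℕ → ℕ → ℕ → ℕ → Set
Compatible N x a y b = ∀ d d′ → d ≤ N → d′ ≤ N →
  ((d + x ≤ d′ + a) ⇔ (d + y ≤ d′ + b)) × ((d + a ≤ d′ + x) ⇔ (d + b ≤ d′ + y))

close-cons : ∀ {N m} {v v′ : Vec ℕ m} {x y} → Close (next N) v v′ →
             (∀ j → Compatible N x (lookup v j) y (lookup v′ j)) → Close N (x ∷ v) (y ∷ v′)
close-cons {N} {m} {v} {v′} {x} {y} (n , n′) comp =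
  go n (λ j d d′ p q → to (proj₁ (comp j d d′ p q))) (λ j d d′ p q → to (proj₂ (comp j d d′ p q))) ,
  go n′ (λ j d d′ p q → from (proj₁ (comp j d d′ p q))) (λ j d d′ p q → from (proj₂ (comp j d d′ p q)))
  where
  go : ∀ {x y} {v v′ : Vec ℕ m} → Near (next N) v v′ →
       (∀ j d d′ → d ≤ N → d′ ≤ N → d + x ≤ d′ + lookup v j → d + y ≤ d′ + lookup v′ j) →
       (∀ j d d′ → d ≤ N → d′ ≤ N → d + lookup v j ≤ d′ + x → d + lookup v′ j ≤ d′ + y) →
       Near N (x ∷ v) (y ∷ v′)
  go {x} {y} {v} {v′} n f g = near pairs
    where
    pairs : ∀ i j d d′ → d ≤ N → d′ ≤ N →
      d + lookup (x ∷ v) i ≤ d′ + lookup (x ∷ v) j → d + lookup (y ∷ v′) i ≤ d′ + lookup (y ∷ v′) j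
    pairs zero    zero    d d′ d≤ d′≤ p = +-monoˡ-≤ _ (+-cancelʳ-≤ _ d d′ p)
    pairs zero    (suc j) d d′ d≤ d′≤ p = f j d d′ d≤ d′≤ p
    pairs (suc i) zero    d d′ d≤ d′≤ p = g i d d′ d≤ d′≤ p
    pairs (suc i) (suc j) d d′ d≤ d′≤ p = ordered (near-mono (n≤next N) n) i j d d′ d≤ d′≤ p

-- With x near entry k and y at the same signed distance c′ - c from its counterpart, a comparison
-- with x at precision N becomes one with entry k at precision `next N`.
anchored : ∀ {N m} {v v′ : Vec ℕ m} → Close (next N) v v′ → ∀ {k c c′ x y} → c ≤ N → c′ ≤ N →
           c + x ≡ c′ + lookup v k → c + y ≡ c′ + lookup v′ k →
           ∀ j → Compatible N x (lookup v j) y (lookup v′ j)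
anchored {N} {m} (n , n′) {k} {c} {c′} c≤ c′≤ e e′ j d d′ d≤ d′≤ =
  mk⇔ (up n e e′) (up n′ e′ e) , mk⇔ (down n e e′) (down n′ e′ e)
  where
  sum≤ : ∀ {a b} → a ≤ N → b ≤ N → a + b ≤ next N
  sum≤ a≤ b≤ = ≤-trans (+-mono-≤ a≤ b≤) (+-mono-≤ (n≤1+n N) (n≤1+n N))
  rebase : ∀ d {x} (v : Vec ℕ m) → c + x ≡ c′ + lookup v k → c + (d + x) ≡ (d + c′) + lookup v k
  rebase d {x} v e = begin
    c + (d + x)             ≡⟨ +-assoc c d x ⟨
    c + d + x               ≡⟨ cong (_+ x) (+-comm c d) ⟩
    d + c + x               ≡⟨ +-assoc d c x ⟩
    d + (c + x)             ≡⟨ cong (d +_) e ⟩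
    d + (c′ + lookup v k)   ≡⟨ +-assoc d c′ _ ⟨
    d + c′ + lookup v k     ∎
    where open ≡-Reasoning
  up : ∀ {x y} {v v′ : Vec ℕ m} → Near (next N) v v′ → c + x ≡ c′ + lookup v k → c + y ≡ c′ + lookup v′ k →
       d + x ≤ d′ + lookup v j → d + y ≤ d′ + lookup v′ j
  up {v = v} {v′} n e e′ p = +-cancelˡ-≤ c _ _
    (subst₂ _≤_ (sym (rebase d v′ e′)) (+-assoc c d′ _)
      (ordered n k j (d + c′) (c + d′) (sum≤ d≤ c′≤) (sum≤ c≤ d′≤)
        (subst₂ _≤_ (rebase d v e) (sym (+-assoc c d′ _)) (+-monoʳ-≤ c p))))
  down : ∀ {x y} {v v′ : Vec ℕ m} → Near (next N) v v′ → c + x ≡ c′ + lookup v k → c + y ≡ c′ + lookup v′ k →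
       d + lookup v j ≤ d′ + x → d + lookup v′ j ≤ d′ + y
  down {v = v} {v′} n e e′ p = +-cancelˡ-≤ c _ _
    (subst₂ _≤_ (+-assoc c d _) (sym (rebase d′ v′ e′))
      (ordered n j k (c + d) (d′ + c′) (sum≤ c≤ d≤) (sum≤ d′≤ c′≤)
        (subst₂ _≤_ (sym (+-assoc c d _)) (rebase d′ v e) (+-monoʳ-≤ c p))))

far-≤ : ∀ {N a x} → N + a < x → ∀ {d} d′ → d ≤ N → d + a ≤ d′ + x
far-≤ {a = a} {x} a<x d′ d≤ = ≤-trans (+-monoˡ-≤ a d≤) (≤-trans (<⇒≤ a<x) (m≤n+m x d′))

far-≰ : ∀ {N a x} → N + a < x → ∀ d {d′} → d′ ≤ N → ¬ d + x ≤ d′ + a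
far-≰ {a = a} {x} a<x d d′≤ p =
  <-irrefl refl (≤-trans a<x (≤-trans (m≤n+m x d) (≤-trans p (+-monoˡ-≤ a d′≤))))

-- At distances above N, offsets up to N never reverse the order, so the side decides every
-- comparison.
separated : ∀ {N x a y b} → (N + a < x × N + b < y) ⊎ (N + x < a × N + y < b) → Compatible N x a y b
separated (inj₁ (a<x , b<y)) d d′ d≤ d′≤ =
  mk⇔ (λ p → contradiction p (far-≰ a<x d d′≤)) (λ p → contradiction p (far-≰ b<y d d′≤)) ,
  mk⇔ (λ _ → far-≤ b<y d′ d≤) (λ _ → far-≤ a<x d′ d≤)
separated (inj₂ (x<a , y<b)) d d′ d≤ d′≤ =
  mk⇔ (λ _ → far-≤ y<b d′ d≤) (λ _ → far-≤ x<a d′ d≤) ,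
  mk⇔ (λ p → contradiction p (far-≰ x<a d d′≤)) (λ p → contradiction p (far-≰ y<b d d′≤))

-- With e false the interval is unbounded above and h is a placeholder.
Span : ℕ → ℕ → Bool → ℕ → Set
Span l h e k = l ≤ k × (e ≡ true → k ≤ h)

-- A set quantifier adds two positions, the end points of an interval, and so costs two rounds.
need : ∀ {p q} → Formula MTL 1 p q → ℕ
need (P a x)  = 0
need (x ≤̇ y)  = 0
need (x ∈̇ X)  = 0
need (¬̇ φ)    = need φ
need (φ ∧̇ ψ)  = need φ ⊔ₙ need ψ
need (∃₁̇ φ)   = next (need φ)
need (∃₂̇ φ)   = next (next (need φ))

Bounds : ℕ → Set
Bounds m = Fin m × Fin m × Bool

sucBounds : ∀ {m} → Bounds m → Bounds (suc m)
sucBounds (l , h , e) = suc l , suc h , e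

Between : ∀ {m} → Vec ℕ m → Bounds m → ℕ → Set
Between v (l , h , e) = Span (lookup v l) (lookup v h) e

-- The valuation is described by the positions v: α and β locate the first-order variables and
-- the end points of the subtrees in v.  The root and the marked node are always listed in v.
record Positions (A : ℕ) {p q m} (xs : Vec (Node (chainTree A)) p) (Xs : Vec WordSet q)
                 (v : Vec ℕ m) (c₀ c₁ : Fin m) (α : Fin p → Fin m) (β : Fin q → Bounds m) : Set where
  field
    root  : lookup v c₀ ≡ 0
    mark  : lookup v c₁ ≡ A
    nodes : ∀ x → length (proj₁ (lookup xs x)) ≡ lookup v (α x)
    sets  : ∀ X k → (zeros k ∈ lookup Xs X) ⇔ Between v (β X) k

open Positions

module _ {A p q m} {xs : Vec (Node (chainTree A)) p} {Xs : Vec WordSet q}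
         {v : Vec ℕ m} {c₀ c₁ : Fin m} {α : Fin p → Fin m} {β : Fin q → Bounds m}
         (pos : Positions A xs Xs v c₀ c₁ α β) where

  add-position : ∀ a → Positions A xs Xs (a ∷ v) (suc c₀) (suc c₁) (suc ∘ α) (sucBounds ∘ β)
  add-position a .root  = root pos
  add-position a .mark  = mark pos
  add-position a .nodes = nodes pos
  add-position a .sets  = sets pos

  add-node : ∀ τ i → length (proj₁ τ) ≡ lookup v i → Positions A (τ ∷ xs) Xs v c₀ c₁ (i ∷ᶠ α) β
  add-node τ i e .root          = root pos
  add-node τ i e .mark          = mark pos
  add-node τ i e .nodes zero    = e
  add-node τ i e .nodes (suc x) = nodes pos x
  add-node τ i e .sets          = sets pos

  add-set : ∀ X b → (∀ k → (zeros k ∈ X) ⇔ Between v b k) → Positions A xs (X ∷ Xs) v c₀ c₁ α (b ∷ᶠ β)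
  add-set X b e .root         = root pos
  add-set X b e .mark         = mark pos
  add-set X b e .nodes        = nodes pos
  add-set X b e .sets zero    = e
  add-set X b e .sets (suc Y) = sets pos Y

close-sym : ∀ {N m} {v v′ : Vec ℕ m} → Close N v v′ → Close N v′ v
close-sym (n , n′) = n′ , n

close-mono : ∀ {M N m} {v v′ : Vec ℕ m} → M ≤ N → Close N v v′ → Close M v v′
close-mono M≤N (n , n′) = near-mono M≤N n , near-mono M≤N n′

close-≤ : ∀ {N m} {v v′ : Vec ℕ m} → Close N v v′ → ∀ i j → lookup v i ≤ lookup v j → lookup v′ i ≤ lookup v′ j
close-≤ (n , _) i j = ordered n i j 0 0 z≤n z≤n

SpanSet : ℕ → ℕ → Bool → WordSet
SpanSet l h e w = w ∈ Chain × Span l h e (length w)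

spanSet-isTree : ∀ {l h e} → l ≤ h → IsTree (SpanSet l h e)
spanSet-isTree {l} {h} {e} l≤h = zeros l , (zeros∈Chain l , in-span ≤-refl λ _ → l≤h) ,
  (λ (w∈ , l≤ , _) → chain-≼ (zeros∈Chain l) w∈ (subst (_≤ _) (sym (length-replicate l)) l≤)) ,
  λ {τ} {τ′} (w∈ , _ , ≤h) p → chain-prefix w∈ (≼-++ˡ (zeros l) p) ,
    subst (_≤ length (zeros l ++ τ′)) (length-replicate l) (≼-length (≼-++ (zeros l) τ′)) ,
    λ b → ≤-trans (≼-length (≼-++ˡ (zeros l) p)) (≤h b)
  where
  in-span : ∀ {k} → l ≤ k → (e ≡ true → k ≤ h) → Span l h e (length (zeros k))
  in-span {k} l≤k k≤h = subst (Span l h e) (sym (length-replicate k)) (l≤k , k≤h)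

zeros∈SpanSet : ∀ l h e k → (zeros k ∈ SpanSet l h e) ⇔ Span l h e k
zeros∈SpanSet l h e k = mk⇔
  (λ (_ , s) → subst (Span l h e) (length-replicate k) s)
  (λ s → zeros∈Chain k , subst (Span l h e) (sym (length-replicate k)) s)

chain-∈ : ∀ {A p q m} {xs : Vec (Node (chainTree A)) p} {Xs : Vec WordSet q} {v : Vec ℕ m} {c₀ c₁ α β} →
          Positions A xs Xs v c₀ c₁ α β → ∀ x X →
          (proj₁ (lookup xs x) ∈ lookup Xs X) ⇔ Between v (β X) (lookup v (α x))
chain-∈ {xs = xs} {Xs} {v} {β = β} pos x X = mk⇔
  (λ i → to (sets pos X _) (subst (_∈ lookup Xs X) eq i))
  (λ s → subst (_∈ lookup Xs X) (sym eq) (from (sets pos X _) s))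
  where
  eq : proj₁ (lookup xs x) ≡ zeros (lookup v _)
  eq = trans (proj₂ (lookup xs x)) (cong zeros (nodes pos x))

-- Offsets up to N cannot bridge the distance from 0 to a mark beyond N, which hides the exact depth
-- of the mark.
close-base : ∀ {N A B} → N < A → N < B → Close N (0 ∷ A ∷ []) (0 ∷ B ∷ [])
close-base N<A N<B = half N<A N<B , half N<B N<A
  where
  half : ∀ {N A B} → N < A → N < B → Near N (0 ∷ A ∷ []) (0 ∷ B ∷ [])
  half {N} {A} {B} N<A N<B = near pairs
    where
    pairs : ∀ i j d d′ → d ≤ N → d′ ≤ N →
      d + lookup (0 ∷ A ∷ []) i ≤ d′ + lookup (0 ∷ A ∷ []) j →
      d + lookup (0 ∷ B ∷ []) i ≤ d′ + lookup (0 ∷ B ∷ []) j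
    pairs zero       zero       d d′ _  _   p = p
    pairs zero       (suc zero) d d′ d≤ _   p = ≤-trans (≤-reflexive (+-identityʳ d))
      (≤-trans (≤-trans d≤ (<⇒≤ N<B)) (m≤n+m B d′))
    pairs (suc zero) zero       d d′ _  d′≤ p = contradiction
      (≤-trans N<A (≤-trans (m≤n+m A d) (≤-trans p (≤-trans (≤-reflexive (+-identityʳ d′)) d′≤)))) (<-irrefl refl)
    pairs (suc zero) (suc zero) d d′ _  _   p = +-monoˡ-≤ B (+-cancelʳ-≤ A d d′ p)

_⋖̇_ : ∀ {L n p q} → Fin p → Fin p → Formula L n p q
x ⋖̇ y = x <̇ y ∧̇ ¬̇ (∃₁̇ suc x <̇ zero ∧̇ zero <̇ suc y)

-- The mark is reached from the root by going down two levels at a time.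
evenFormula : Sentence WMSO 1
evenFormula = ∃₂̇
  (∃₁̇ zero ∈̇ zero ∧̇ (∀₁̇ suc zero ≤̇ zero))
  ∧̇ (∀₁̇ zero ∈̇ zero ⇒̇ ¬̇ P zero zero ⇒̇
       (∃₁̇ ∃₁̇ suc (suc zero) ⋖̇ suc zero ∧̇ suc zero ⋖̇ zero ∧̇ zero ∈̇ zero))

Covers : WordSet → Word → Word → Set
Covers T x y = x ≺ y × ¬ (Σ[ (z , _) ∈ Σ Word T ] x ≺ z × z ≺ y)

covers-length : ∀ {x y} → x ∈ Chain → y ∈ Chain → Covers Chain x y → length y ≡ suc (length x)
covers-length {x} {y} x∈ y∈ (x≺y , none) = sym (≤-antisym (≺-length x≺y) (≮⇒≥ λ lt →
  none ((z , zeros∈Chain _) , chain-≺ x∈ (zeros∈Chain _) (≤-reflexive (sym len)) ,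
        chain-≺ (zeros∈Chain _) y∈ (subst (_< length y) (sym len) lt))))
  where
  z = zeros (suc (length x))
  len : length z ≡ suc (length x)
  len = length-replicate _
  chain-≺ : ∀ {u v} → u ∈ Chain → v ∈ Chain → length u < length v → u ≺ v
  chain-≺ u∈ v∈ lt = chain-≼ u∈ v∈ (<⇒≤ lt) , λ p → <-irrefl refl (≤-trans lt (≼-length p))

length-covers : ∀ k → Covers Chain (zeros k) (zeros (suc k))
length-covers k =
  (zeros-≼ (n≤1+n k) , λ p → <-irrefl refl
    (subst₂ _≤_ (length-replicate (suc k)) (length-replicate k) (≼-length p))) ,
  λ (_ , k≺z , z≺k) → <-irrefl refl (≤-trans (s≤s (≺-length k≺z))
    (≤-trans (≺-length z≺k)
      (≤-reflexive (trans (length-replicate (suc k)) (cong suc (sym (length-replicate k)))))))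

module _ (A : ℕ) where

  EvenSteps : WordSet → Set
  EvenSteps X =
    (Σ[ (x , _) ∈ Σ Word Chain ] x ∈ X × (((y , _) : Σ Word Chain) → x ≼ y))
    × (((x , _) : Σ Word Chain) → x ∈ X → ¬ zero ∈ˢ Marked A x →
         Σ[ (z , _) ∈ Σ Word Chain ] Σ[ (y , _) ∈ Σ Word Chain ] Covers Chain x z × Covers Chain z y × y ∈ X)

module Classical (em : ∀ {ℓ} → ExcludedMiddle ℓ) where

  -- Translations between the logics

  dne : ∀ {a} {A : Set a} → ¬ ¬ A → A
  dne = decidable-stable em

  module _ {L : Logic} {n p q : ℕ} {K : KripkeTree n} {xs : Vec (Node K) p} {Xs : Vec WordSet q} where

    module _ {a b} {A : Set a} {B : Set b} {φ ψ : Formula L n p q} where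

      means-⇒ : Means K xs Xs φ A → Means K xs Xs ψ B → Means K xs Xs (φ ⇒̇ ψ) (A → B)
      means-⇒ m o = means (λ s a → dne λ ¬b → s (complete m a , ¬b ∘ sound o))
                          (λ f s → proj₂ s (complete o (f (sound m (proj₁ s)))))

    module _ {a} {A : Node K → Set a} {φ : Formula L n (suc p) q} where

      means-∀₁ : (∀ τ → Means K (τ ∷ xs) Xs φ (A τ)) → Means K xs Xs (∀₁̇ φ) (∀ τ → A τ)
      means-∀₁ m = means (λ s τ → dne λ ¬a → s (τ , ¬a ∘ sound (m τ)))
                         (λ f s → proj₂ s (complete (m _) (f _)))

    module _ {a} {A : WordSet → Set a} {φ : Formula L n p (suc q)} where

      means-∀₂ : (∀ X → Means K xs (X ∷ Xs) φ (A X)) →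
                 Means K xs Xs (∀₂̇ φ) (∀ X → X ∈ Range L (tree K) → A X)
      means-∀₂ m = means (λ s X r → dne λ ¬a → s (X , r , ¬a ∘ sound (m X)))
                         (λ f s → proj₂ (proj₂ s) (complete (m _) (f _ (proj₁ (proj₂ s)))))

  module _ {n} (K : KripkeTree n) where

    treeFormula-means : ∀ {L p q} (xs : Vec (Node K) p) (Xs : Vec WordSet q) X →
                        Means K xs (X ∷ Xs) (treeFormula {L}) (TreeMeaning K X)
    treeFormula-means xs Xs X =
      means-∃₁ λ _ → means-∧ means-∈ (means-∧
        (means-∀₁ λ _ → means-⇒ means-∈ means-≤)
        (means-∀₁ λ _ → means-∀₁ λ _ →
           means-⇒ means-∈ (means-⇒ means-≤ (means-⇒ means-≤ means-∈))))

    treeFormula-sat : ∀ {L p q} (xs : Vec (Node K) p) (Xs : Vec WordSet q) X → X ⊆ tree K →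
                      IsTree X ⇔ Sat {L} K xs (X ∷ Xs) treeFormula
    treeFormula-sat {L} xs Xs X X⊆T =
      let eq = isTree⇔TreeMeaning K X⊆T
          m = treeFormula-means {L} xs Xs X
      in mk⇔ (complete m ∘ to eq) (from eq ∘ sound m)

  MTL≤MSO : ∀ {C} → MTL ≤[ C ] MSO
  MTL≤MSO {C} = ≤-by-relativising {MTL} {MSO} {C} treeFormula λ K _ xs Xs X → mk⇔
    (λ (X⊆T , t) → X⊆T , to (treeFormula-sat K {MSO} xs Xs X X⊆T) t)
    (λ (X⊆T , s) → X⊆T , from (treeFormula-sat K {MSO} xs Xs X X⊆T) s)

  WMTL≤WMSO : ∀ {C} → WMTL ≤[ C ] WMSO
  WMTL≤WMSO {C} = ≤-by-relativising {WMTL} {WMSO} {C} treeFormula λ K _ xs Xs X → mk⇔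
    (λ (X⊆T , t , fin) → (X⊆T , fin) , to (treeFormula-sat K {WMSO} xs Xs X X⊆T) t)
    (λ ((X⊆T , fin) , s) → X⊆T , from (treeFormula-sat K {WMSO} xs Xs X X⊆T) s , fin)

  -- `Finite` asks for a list of exactly the elements of X; excluded middle filters one out of any
  -- covering list.
  covered⇒finite : ∀ {X : WordSet} τs → X ⊆ (_∈ˡ τs) → Finite X
  covered⇒finite {X} τs X⊆τs =
    filter dec τs , (λ x∈X → ∈-filter⁺ dec (X⊆τs x∈X) x∈X) , proj₂ ∘ ∈-filter⁻ dec {xs = τs}
    where
    dec : ∀ w → Dec (X w)
    dec w = em

  finite-⊆ : ∀ {X Y : WordSet} → X ⊆ Y → Finite Y → Finite X
  finite-⊆ X⊆Y (τs , Y⊆τs , _) = covered⇒finite τs (Y⊆τs ∘ X⊆Y)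

  finite-∪ : ∀ {X Y : WordSet} → Finite X → Finite Y → Finite (X ∪ Y)
  finite-∪ (τs , X⊆τs , _) (σs , Y⊆σs , _) =
    covered⇒finite (τs ++ σs) [ ∈-++⁺ˡ ∘ X⊆τs , ∈-++⁺ʳ τs ∘ Y⊆σs ]

  finite-⋃ : ∀ (Y : Word → WordSet) τs → (∀ {τ} → τ ∈ˡ τs → Finite (Y τ)) →
             Finite (λ w → ∃[ τ ] τ ∈ˡ τs × w ∈ Y τ)
  finite-⋃ Y []       fin = [] , (λ ()) , λ ()
  finite-⋃ Y (τ ∷ τs) fin =
    finite-⊆ (λ { (_ , here refl , w∈Y) → inj₁ w∈Y ; (σ , there σ∈ , w∈Y) → inj₂ (σ , σ∈ , w∈Y) })
             (finite-∪ (fin (here refl)) (finite-⋃ Y τs (fin ∘ there)))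

  module _ {n} (K : KripkeTree n) where

    finiteFormula-means : ∀ {L p q} (xs : Vec (Node K) p) (Xs : Vec WordSet q) X →
      Means K xs (X ∷ Xs) (finiteFormula {L}) (¬ (∃[ Π ] Π ∈ Range L (tree K) × Thick K X Π))
    finiteFormula-means xs Xs X = means-¬ (means-∃₂ λ _ → means-∧ (means-∃₁ λ _ → means-∈)
      (means-∀₁ λ _ → means-⇒ means-∈ (means-∧
        (means-∃₁ λ _ → means-∧ means-∈ means-<)
        (means-∃₁ λ _ → means-∧ means-∈ means-≤))))

    module _ {X : WordSet} (X⊆T : X ⊆ tree K) (inf : ¬ Finite X) where

      -- A prefix keeps all descendants of the longer node, so having infinitely many of them in X
      -- passes to prefixes.
      unbounded-isTree : IsTree (Unbounded K X)
      unbounded-isTree with τ₀ , τ₀∈T , root , closed ← isTree K =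
        τ₀ , (τ₀∈T , λ fin → inf (finite-⊆ (λ w∈X → w∈X , root (X⊆T w∈X)) fin)) , root ∘ proj₁ ,
        λ {τ} (τ∈T , ¬fin) p → closed {τ} τ∈T p ,
          λ fin → ¬fin (finite-⊆ (map₂ (≼-trans (≼-++ˡ τ₀ p))) fin)

      -- König's argument: if each of the finitely many children of x had only finitely many members
      -- of X below it, so would x.
      unbounded-thick : FinitelyBranching (tree K) → Thick K X (Unbounded K X)
      unbounded-thick fb =
        ((_ , proj₁ (proj₁ (proj₂ unbounded-isTree))) , proj₁ (proj₂ unbounded-isTree)) ,
        λ (x , x∈T) (_ , ¬fin) →
          (dne λ noChild → ¬fin (finite-⊆ (split x∈T) (finite-∪
             (covered⇒finite (x ∷ []) λ { refl → here refl })
             (finite-⋃ (Above X) (proj₁ (fb x∈T)) λ {τ} τ∈ → dne λ ¬fin′ →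
                let τ∈T , m , τ≡ = proj₂ (proj₂ (fb x∈T)) τ∈
                in noChild ((τ , τ∈T) , (τ∈T , ¬fin′) , subst (x ≺_) (sym τ≡) (suffix-≺ x m [])))))) ,
          dne λ none → ¬fin (covered⇒finite [] λ (w∈X , x≼w) → contradiction ((_ , X⊆T w∈X) , w∈X , x≼w) none)
        where
        split : ∀ {x} (x∈T : x ∈ tree K) →
                Above X x ⊆ ((x ≡_) ∪ (λ w → ∃[ τ ] τ ∈ˡ proj₁ (fb x∈T) × w ∈ Above X τ))
        split {x} x∈T {w} (w∈X , x≼w) with ≼-suffix x≼w
        ... | []    , refl = inj₁ (sym (++-identityʳ x))
        ... | a ∷ v , refl = inj₂ (x ∷ʳ a , proj₁ (proj₂ (fb x∈T)) (child∈T , a , refl) , w∈X , child≼w)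
          where
          child≼w : x ∷ʳ a ≼ x ++ a ∷ v
          child≼w = ≼-++ˡ x (refl ∷ [])
          child∈T : x ∷ʳ a ∈ tree K
          child∈T = tree-≼-closed (isTree K) (X⊆T w∈X)
                      (≼-trans (proj₁ (proj₂ (proj₂ (isTree K))) x∈T) (≼-++ x _)) child≼w

    finiteFormula-sat : FinitelyBranching (tree K) → ∀ {L} →
      (∀ {Π} → Π ⊆ tree K → IsTree Π → Π ∈ Range L (tree K)) →
      ∀ {p q} (xs : Vec (Node K) p) (Xs : Vec WordSet q) X → X ⊆ tree K →
      Finite X ⇔ Sat {L} K xs (X ∷ Xs) finiteFormula
    finiteFormula-sat fb {L} trees xs Xs X X⊆T =
      let m = finiteFormula-means {L} xs Xs X in mk⇔
        (λ fin → complete m λ (Π , _ , thick) → thick⇒infinite K thick fin)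
        (λ s → dne λ inf → sound m s (Unbounded K X , trees proj₁ (unbounded-isTree X⊆T inf) ,
                                       unbounded-thick X⊆T inf fb))

  WMSO≤MSO : WMSO ≤[ FinitelyBranchingKripkeTrees ] MSO
  WMSO≤MSO = ≤-by-relativising {WMSO} {MSO} {FinitelyBranchingKripkeTrees} finiteFormula λ K fb xs Xs X →
    let finite⇔ = finiteFormula-sat K fb {MSO} (λ Π⊆T _ → Π⊆T) xs Xs X in mk⇔
      (λ (X⊆T , fin) → X⊆T , to (finite⇔ X⊆T) fin)
      (λ (X⊆T , s) → X⊆T , from (finite⇔ X⊆T) s)

  WMTL≤MTL : WMTL ≤[ FinitelyBranchingKripkeTrees ] MTL
  WMTL≤MTL = ≤-by-relativising {WMTL} {MTL} {FinitelyBranchingKripkeTrees} finiteFormula λ K fb xs Xs X →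
    let finite⇔ = finiteFormula-sat K fb {MTL} _,_ xs Xs X in mk⇔
      (λ (X⊆T , t , fin) → (X⊆T , t) , to (finite⇔ X⊆T) fin)
      (λ ((X⊆T , t) , s) → X⊆T , t , from (finite⇔ X⊆T) s)

  -- WMTL ≰ MSO

  size : ∀ N A → AtLeast N A ⊎ ∃[ m ] m < N × Exactly m A
  size zero    A = inj₁ tt
  size (suc N) A with em {P = AtLeast (suc N) A} | size N A
  ... | yes al | _                    = inj₁ al
  ... | no ¬al | inj₁ al              = inj₂ (N , ≤-refl , al , ¬al)
  ... | no ¬al | inj₂ (m , m<N , exa) = inj₂ (m , ≤-trans m<N (n≤1+n N) , exa)

  module _ {N L : ℕ} {A B A₀ : Pred ℕ 0ℓ} (A~B : Equinumerous (N + L) A B) (A₀⊆A : A₀ ⊆ A) where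

    private
      A₁ = A ∖∖ A₀

      total : ∀ {a b} → a ≤ N → b ≤ L → AtLeast a A₀ → AtLeast b A₁ → AtLeast (a + b) B
      total {a} {b} a≤ b≤ al al′ = to (counts A~B (a + b) (+-mono-≤ a≤ b≤))
        (atLeast-⊆ (a + b) [ A₀⊆A , proj₁ ] (atLeast-∪ a (λ x∈ (_ , x∉) → x∉ x∈) al al′))

      cover : A ⊆ (A₀ ∪ A₁)
      cover {x} x∈ with em {P = A₀ x}
      ... | yes x∈₀ = inj₁ x∈₀
      ... | no x∉₀  = inj₂ (x∈ , x∉₀)

      -- Pigeonhole: a + b + 1 elements of A would put more than a into A₀ or more than b into A₁.
      few : ∀ {a b} → a < N → b < L → ¬ AtLeast (suc a) A₀ → ¬ AtLeast (suc b) A₁ → ¬ AtLeast (suc a + b) B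
      few {a} {b} a<N b<L ¬al ¬al′ al
        with a′ , b′ , e , al₀ , al₁ ← atLeast-∪⁻ (suc a + b) (atLeast-⊆ (suc a + b) cover
               (from (counts A~B (suc a + b) (+-mono-≤ a<N (<⇒≤ b<L))) al))
        with a <? a′
      ... | yes a<a′ = ¬al (atLeast-≤ a<a′ al₀)
      ... | no a≮a′  = ¬al′ (atLeast-≤ (≰⇒> λ b′≤b →
            <-irrefl refl (subst (_≤ a + b) e (+-mono-≤ (≮⇒≥ a≮a′) b′≤b))) al₁)

    -- A small part of A is reproduced exactly, a large one up to its bound; the cases differ in
    -- which part of B is carved out first.
    split-equinumerous : ∃[ B₀ ] (B₀ ⊆ B × Equinumerous N A₀ B₀ × Equinumerous L A₁ (B ∖∖ B₀))
    split-equinumerous with size N A₀ | size L A₁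
    ... | inj₁ al | inj₁ al′ =
      let B₀ , B₀⊆ , (al₀ , _) , al₁ = split-off N (total ≤-refl ≤-refl al al′) in
      B₀ , B₀⊆ , equinumerous-many al al₀ , equinumerous-many al′ al₁
    ... | inj₂ (a , a<N , ex) | inj₁ al′ =
      let B₀ , B₀⊆ , ex₀ , al₁ = split-off a (total (<⇒≤ a<N) ≤-refl (proj₁ ex) al′) in
      B₀ , B₀⊆ , equinumerous-exact ex ex₀ , equinumerous-many al′ al₁
    -- Only A₁ is small: its counterpart B₁ is carved out exactly, and B₀ is the complement.
    ... | inj₁ al | inj₂ (b , b<L , ex) =
      let B₁ , B₁⊆ , ex₁ , al₀ = split-off b {N} (subst (λ n → AtLeast n B) (+-comm N b)
                                   (total ≤-refl (<⇒≤ b<L) al (proj₁ ex))) in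
      B ∖∖ B₁ , proj₁ , equinumerous-many al al₀ ,
      equinumerous-≐ (id , id) ((λ x∈₁ → B₁⊆ x∈₁ , λ (_ , x∉₁) → x∉₁ x∈₁) ,
        λ (x∈ , ¬x∉₁) → dne λ x∉₁ → ¬x∉₁ (x∈ , x∉₁)) (equinumerous-exact ex ex₁)
    -- With both parts small, `few` bounds B, so at most b elements remain beside B₀.
    ... | inj₂ (a , a<N , ex) | inj₂ (b , b<L , ex′) =
      let B₀ , B₀⊆ , ex₀ , al₁ = split-off a (total (<⇒≤ a<N) (<⇒≤ b<L) (proj₁ ex) (proj₁ ex′)) in
      B₀ , B₀⊆ , equinumerous-exact ex ex₀ , equinumerous-exact ex′ (al₁ , λ al →
        few a<N b<L (proj₂ ex) (proj₂ ex′)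
          (subst (λ n → AtLeast n B) (+-suc a b)
            (atLeast-⊆ (a + suc b) [ B₀⊆ , proj₁ ] (atLeast-∪ a (λ x∈ (_ , x∉) → x∉ x∈) (proj₁ ex₀) al))))

  -- Induction on the number of colours: the top colour takes N from the budget M * N + 1. That
  -- every colour used on B occurs on A allows the branches of B to be answered later.
  refine : ∀ M {N} → 1 ≤ N → ∀ {A B : Pred ℕ 0ℓ} (f : ℕ → ℕ) → (∀ {x} → A x → f x < M) →
           Equinumerous (suc (M * N)) A B →
           ∃[ g ] ((∀ {y} → B y → ∃[ x ] A x × f x ≡ g y) × ∀ s → Equinumerous N (Fibre A f s) (Fibre B g s))
  -- Without colours A is empty, and the last unit of the budget makes B empty too.
  refine zero {N} 1≤N f f< A~B = (λ _ → 0) ,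
    (λ y∈ → let x , x∈ = equinumerous-witness ≤-refl (equinumerous-sym A~B) y∈ in contradiction (f< x∈) n≮0) ,
    λ s → equinumerous-empty (λ x (x∈ , _) → n≮0 (f< x∈))
      (λ y (y∈ , _) → let x , x∈ = equinumerous-witness ≤-refl (equinumerous-sym A~B) y∈ in n≮0 (f< x∈))
  refine (suc M) {N} 1≤N {A} {B} f f< A~B
    with B₀ , B₀⊆ , e₀ , e₁ ← split-equinumerous {N} {suc (M * N)} {A₀ = Fibre A f M}
           (subst (λ n → Equinumerous n A B) (sym (+-suc N (M * N))) A~B) proj₁
    with g′ , real , e ← refine M 1≤N {A ∖∖ Fibre A f M} {B ∖∖ B₀} f
           (λ (x∈ , x∉) → ≤∧≢⇒< (≤-pred (f< x∈)) (λ ≡M → x∉ (x∈ , ≡M))) e₁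
    = g , realised , fibres
    where
    pick : ∀ {y} → Dec (B₀ y) → ℕ
    pick     (yes _) = M
    pick {y} (no _)  = g′ y
    g : ℕ → ℕ
    g y = pick {y} em
    g-in : ∀ {y} → B₀ y → g y ≡ M
    g-in {y} y∈ with em {P = B₀ y}
    ... | yes _ = refl
    ... | no y∉ = contradiction y∈ y∉
    g-out : ∀ {y} → ¬ B₀ y → g y ≡ g′ y
    g-out {y} y∉ with em {P = B₀ y}
    ... | yes y∈ = contradiction y∈ y∉
    ... | no _   = refl
    realised : ∀ {y} → B y → ∃[ x ] A x × f x ≡ g y
    realised {y} y∈ with em {P = B₀ y}
    ... | yes y∈₀ = equinumerous-witness 1≤N (equinumerous-sym e₀) y∈₀
    ... | no y∉₀  = let x , (x∈ , _) , fx≡ = real (y∈ , y∉₀) in x , x∈ , fx≡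
    g′≢M : ∀ {y} → (B ∖∖ B₀) y → g′ y ≢ M
    g′≢M y∈ ≡M = let x , (x∈ , x∉) , fx≡ = real y∈ in x∉ (x∈ , trans fx≡ ≡M)
    fibres : ∀ s → Equinumerous N (Fibre A f s) (Fibre B g s)
    fibres s with s ≟ₙ M
    ... | yes refl = equinumerous-≐ (id , id)
      ((λ y∈ → B₀⊆ y∈ , g-in y∈) ,
       λ (y∈ , ≡M) → dne λ y∉₀ → g′≢M (y∈ , y∉₀) (trans (sym (g-out y∉₀)) ≡M)) e₀
    ... | no s≢M   = equinumerous-≐
      ((λ ((x∈ , _) , ≡s) → x∈ , ≡s) , λ { (x∈ , refl) → (x∈ , λ (_ , ≡M) → s≢M ≡M) , refl })
      ((λ ((y∈ , y∉₀) , ≡s) → y∈ , trans (g-out y∉₀) ≡s) ,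
       λ {y} (y∈ , ≡s) → let y∉₀ = λ y∈₀ → s≢M (trans (sym ≡s) (g-in y∈₀)) in
         (y∈ , y∉₀) , trans (sym (g-out y∉₀)) ≡s)
      (e s)

  -- Each class of B is coloured after the same class of A, and each colour is then summed over the
  -- H classes.
  refine-classes : ∀ H M {N} → 1 ≤ N → ∀ {A B : Pred ℕ 0ℓ} (h k f : ℕ → ℕ) →
    (∀ x → h x < H) → (∀ y → k y < H) → (∀ x → f x < M) →
    (∀ t → Equinumerous (suc (M * N)) (Fibre A h t) (Fibre B k t)) →
    ∃[ g ] ((∀ {y} → B y → ∃[ x ] A x × h x ≡ k y × f x ≡ g y) ×
            ∀ s → Equinumerous N (Fibre A f s) (Fibre B g s))
  refine-classes H M {N} 1≤N {A} {B} h k f h< k< f< A~B =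
    (λ y → g (k y) y) ,
    (λ y∈ → let x , (x∈ , hx≡) , fx≡ = proj₁ (proj₂ (class _)) (y∈ , refl) in x , x∈ , hx≡ , fx≡) ,
    λ s → equinumerous-⋃ H h k (λ {x} _ → h< x) (λ {y} _ → k< y) λ t →
      equinumerous-≐
        ((λ ((x∈ , ≡t) , ≡s) → (x∈ , ≡s) , ≡t) , λ ((x∈ , ≡s) , ≡t) → (x∈ , ≡t) , ≡s)
        ((λ { ((y∈ , refl) , ≡s) → (y∈ , ≡s) , refl }) , λ { ((y∈ , ≡s) , refl) → (y∈ , refl) , ≡s })
        (proj₂ (proj₂ (class t)) s)
    where
    class = λ t → refine M 1≤N f (λ {x} _ → f< x) (A~B t)
    g = λ t → proj₁ (class t)

  -- Back-and-forth types of branches.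

  flag : ∀ {ℓ} → Set ℓ → Fin 2
  flag A = if does (em {P = A}) then suc zero else zero

  flag-≡ : ∀ {ℓ ℓ′} {A : Set ℓ} {B : Set ℓ′} → flag A ≡ flag B → A → B
  flag-≡ {A = A} {B} e a with em {P = A} | em {P = B}
  ... | yes _ | yes b = b
  ... | no ¬a | _     = contradiction a ¬a

  -- The Hintikka type of rank r coded as a number: a table of atomic facts at rank 0, afterwards
  -- the set of types realised by adding one set.
  branchType : ∀ r {m} → Vec WordSet m → Fin (typeCount r m)
  branchType zero    c = funToFin λ i → funToFin λ j → funToFin λ o → flag (Atom o (lookup c i) (lookup c j))
  branchType (suc r) c = funToFin λ t → flag (∃[ X ] branchType r (X ∷ c) ≡ t)

  branchType-extend : ∀ r {m} {c d : Vec WordSet m} → branchType (suc r) c ≡ branchType (suc r) d →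
                      ∀ X → ∃[ Y ] branchType r (Y ∷ d) ≡ branchType r (X ∷ c)
  branchType-extend r e X = flag-≡ (funToFin-injective e (branchType r (X ∷ _))) (X , refl)

  branchType-atom : ∀ r {m} {c d : Vec WordSet m} → branchType r c ≡ branchType r d →
                    ∀ o i j → Atom o (lookup c i) (lookup c j) → Atom o (lookup d i) (lookup d j)
  branchType-atom zero {c = c} {d} e o i j = flag-≡ (funToFin-injective
    {f = λ o → flag (Atom o (lookup c i) (lookup c j))} {λ o → flag (Atom o (lookup d i) (lookup d j))}
    (funToFin-injective (funToFin-injective e i) j) o)
  branchType-atom (suc r) e o i j a =
    -- The empty set is added as a dummy, only to descend by one rank.
    let Y , e′ = branchType-extend r e (λ _ → ⊥) in branchType-atom r (sym e′) o (suc i) (suc j) a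

  typeOf : ∀ r {m} → Vec WordSet m → ℕ → ℕ
  typeOf r Zs i = toℕ (branchType r (branch i Zs))

  -- The invariant of the game on bushes: roots are compared directly, branches only through the
  -- number of each type, counted up to the threshold.
  record Alike (r : ℕ) {m} (D E : Pred ℕ 0ℓ) (Zs Ws : Vec WordSet m) : Set where
    field
      inˡ   : ∀ i → lookup Zs i ⊆ Bush D
      inʳ   : ∀ i → lookup Ws i ⊆ Bush E
      roots : ∀ i → ([] ∈ lookup Zs i) ⇔ ([] ∈ lookup Ws i)
      types : ∀ t → Equinumerous (threshold r m) (Fibre D (typeOf r Zs) t) (Fibre E (typeOf r Ws) t)

  open Alike

  alike-sym : ∀ {r m D E} {Zs Ws : Vec WordSet m} → Alike r D E Zs Ws → Alike r E D Ws Zs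
  alike-sym a .inˡ     = inʳ a
  alike-sym a .inʳ     = inˡ a
  alike-sym a .roots i = mk⇔ (from (roots a i)) (to (roots a i))
  alike-sym a .types t = equinumerous-sym (types a t)

  module _ {r m D E} {Zs Ws : Vec WordSet m} (alike : Alike r D E Zs Ws) where

    alike-branch : ∀ {a} → D a → ∃[ b ] branchType r (branch a Zs) ≡ branchType r (branch b Ws)
    alike-branch a∈ =
      let b , _ , e = equinumerous-witness (1≤threshold r m) (types alike _) (a∈ , refl)
      in b , toℕ-injective (sym e)

    alike-below : ∀ o i j {a} → D a →
      Atom o (λ w → lookup Zs i (a ∷ w)) (λ w → lookup Zs j (a ∷ w)) →
      ∃[ b ] Atom o (λ w → lookup Ws i (b ∷ w)) (λ w → lookup Ws j (b ∷ w))
    alike-below o i j {a} a∈ at =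
      let b , e = alike-branch a∈ in
      b , subst₂ (Atom o) (lookup-map i _ Ws) (lookup-map j _ Ws)
            (branchType-atom r e o i j (subst₂ (Atom o) (sym (lookup-map i _ Zs)) (sym (lookup-map j _ Zs)) at))

    alike-meets : ∀ i j → Meets (lookup Zs i) (lookup Zs j) → Meets (lookup Ws i) (lookup Ws j)
    alike-meets i j ([] , p , q)    = [] , to (roots alike i) p , to (roots alike j) q
    alike-meets i j (a ∷ w , p , q) =
      let b , v , p′ , q′ = alike-below zero i j (inˡ alike i p) (w , p , q) in b ∷ v , p′ , q′

    alike-reaches : ∀ i j → Reaches (lookup Zs i) (lookup Zs j) → Reaches (lookup Ws i) (lookup Ws j)
    -- The root reaches everything, so only nonemptiness of the second set is transferred, as its
    -- meeting itself.
    alike-reaches i j ([] , w , p , q , _) =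
      let v , q′ , _ = alike-meets j j (w , q , q) in [] , v , to (roots alike i) p , q′ , []
    alike-reaches i j (a ∷ v , .a ∷ w , p , q , refl ∷ le) =
      let b , v′ , w′ , p′ , q′ , le′ = alike-below (suc zero) i j (inˡ alike i p) (v , w , p , q , le)
      in b ∷ v′ , b ∷ w′ , p′ , q′ , refl ∷ le′

  -- `refine-classes` distributes the finer types over the branches of E. On each of them Y answers
  -- the part of X on a branch of D that has the same old type and the assigned new one.
  alike-extend : ∀ {r m D E} {Zs Ws : Vec WordSet m} → Alike (suc r) D E Zs Ws →
                 ∀ X → X ⊆ Bush D → ∃[ Y ] Alike r D E (X ∷ Zs) (Y ∷ Ws)
  alike-extend {r} {m} {D} {E} {Zs} {Ws} alike X X⊆D = Y , record
    { inˡ   = λ { zero → X⊆D ; (suc i) → inˡ alike i }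
    ; inʳ   = λ { zero {w} → Y⊆E {w} ; (suc i) → inʳ alike i }
    ; roots = λ { zero → mk⇔ id id ; (suc i) → roots alike i }
    ; types = λ t → equinumerous-≐ (id , id)
        ((λ (y∈ , ≡t) → y∈ , trans (typed y∈) ≡t) , λ (y∈ , ≡t) → y∈ , trans (sym (typed y∈)) ≡t)
        (proj₂ (proj₂ refined) t)
    }
    where
    refined = refine-classes (typeCount (suc r) m) (typeCount r (suc m)) (1≤threshold r (suc m)) {D} {E}
      (typeOf (suc r) Zs) (typeOf (suc r) Ws) (typeOf r (X ∷ Zs)) (λ _ → toℕ<n _) (λ _ → toℕ<n _) (λ _ → toℕ<n _)
      (types alike)
    g = proj₁ refined
    answer : ∀ j → E j → ∃[ Y ] toℕ (branchType r (Y ∷ branch j Ws)) ≡ g j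
    answer j j∈ =
      let i , i∈ , hi≡ , fi≡ = proj₁ (proj₂ refined) j∈
          Y , e = branchType-extend r (toℕ-injective hi≡) (λ w → X (i ∷ w))
      in Y , trans (cong toℕ e) fi≡
    pick : ∀ j → Dec (E j) → WordSet
    pick j (yes j∈) = proj₁ (answer j j∈)
    pick j (no _)   = λ _ → ⊥
    Y : WordSet
    Y []      = X []
    Y (j ∷ w) = pick j em w
    Y⊆E : Y ⊆ Bush E
    Y⊆E {[]}    _ = tt
    Y⊆E {j ∷ w} i with em {P = E j}
    ... | yes j∈ = j∈
    typed : ∀ {j} → E j → typeOf r (Y ∷ Ws) j ≡ g j
    typed {j} j∈ with em {P = E j}
    ... | yes j∈′ = proj₂ (answer j j∈′)
    ... | no j∉   = contradiction j∈ j∉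

  -- A second element of Y could be separated from the first by a further set; X admits no such set.
  alike-singleton : ∀ {r m D E X x Y} {Zs Ws : Vec WordSet m} → Alike (2 + r) D E (X ∷ Zs) (Y ∷ Ws) →
                    X ≐ (_≡ x) → ∃[ y ] Y ≐ (_≡ y)
  alike-singleton {X = X} {x} {Y} alike (X⊆ , ⊆X) =
    let y , y∈ , _ = alike-meets alike zero zero (x , ⊆X refl , ⊆X refl) in
    y , unique y∈ , λ { refl → y∈ }
    where
    unique : ∀ {y} → y ∈ Y → Y ⊆ (_≡ y)
    unique {y} y∈ {z} z∈ =
      let Y₁ , alike₁ = alike-extend (alike-sym alike) (_≡ y) (λ { refl → inʳ alike zero y∈ })
          Y₂ , alike₂ = alike-extend alike₁ (_≡ z) (λ { refl → inʳ alike zero z∈ })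
          u , u∈X , u∈Y₁ = alike-meets alike₂ (suc (suc zero)) (suc zero) (y , y∈ , refl)
          v , v∈X , v∈Y₂ = alike-meets alike₂ (suc (suc zero)) zero (z , z∈ , refl)
          w , w≡z , w≡y = alike-meets (alike-sym alike₂) zero (suc zero)
                            (u , subst Y₂ (trans (X⊆ v∈X) (sym (X⊆ u∈X))) v∈Y₂ , u∈Y₁)
      in trans (sym w≡z) w≡y

  -- Node variables are represented by singletons, so that all variables become entries of one list
  -- of sets.
  record Represents {D} {d : ∃[ i ] D i} {p q m} (Zs : Vec WordSet m) (α : Fin p → Fin m) (β : Fin q → Fin m)
                    (xs : Vec (Node (bushTree D d)) p) (Xs : Vec WordSet q) : Set where
    field
      nodes : ∀ x → lookup Zs (α x) ≐ (_≡ proj₁ (lookup xs x))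
      sets  : ∀ X → lookup Zs (β X) ≐ lookup Xs X

  open Represents

  module _ {D} {d : ∃[ i ] D i} {p q m} {Zs : Vec WordSet m} {α : Fin p → Fin m} {β : Fin q → Fin m}
           {xs : Vec (Node (bushTree D d)) p} {Xs : Vec WordSet q} (rep : Represents {D} {d} Zs α β xs Xs) where

    represents-node : ∀ {X} τ → X ≐ (_≡ proj₁ τ) →
                      Represents {D} {d} (X ∷ Zs) (zero ∷ᶠ (suc ∘ α)) (suc ∘ β) (τ ∷ xs) Xs
    represents-node τ X≐ .nodes zero    = X≐
    represents-node τ X≐ .nodes (suc x) = nodes rep x
    represents-node τ X≐ .sets          = sets rep

    represents-set : ∀ X → Represents {D} {d} (X ∷ Zs) (suc ∘ α) (zero ∷ᶠ (suc ∘ β)) xs (X ∷ Xs)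
    represents-set X .nodes        = nodes rep
    represents-set X .sets zero    = id , id
    represents-set X .sets (suc Y) = sets rep Y

    represents-∈ : ∀ x X → (proj₁ (lookup xs x) ∈ lookup Xs X) ⇔ Meets (lookup Zs (α x)) (lookup Zs (β X))
    represents-∈ x X = mk⇔
      (λ i → _ , proj₂ (nodes rep x) refl , proj₂ (sets rep X) i)
      (λ (w , w∈ , w∈′) → subst (lookup Xs X) (proj₁ (nodes rep x) w∈) (proj₁ (sets rep X) w∈′))

    represents-≤ : ∀ x y → (proj₁ (lookup xs x) ≼ proj₁ (lookup xs y)) ⇔
                   Reaches (lookup Zs (α x)) (lookup Zs (α y))
    represents-≤ x y = mk⇔
      (λ le → _ , _ , proj₂ (nodes rep x) refl , proj₂ (nodes rep y) refl , le)
      (λ (v , w , v∈ , w∈ , le) → subst₂ _≼_ (proj₁ (nodes rep x) v∈) (proj₁ (nodes rep y) w∈) le)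

  -- Ehrenfeucht-Fraïssé argument: `alike-extend` answers each quantifier and negation swaps the
  -- sides. There are no atomic propositions, hence no clause for labels.
  alike-sat : ∀ {D E d e r p q m} (φ : Formula MSO 0 p q) → rank φ ≤ r →
              ∀ {Zs Ws : Vec WordSet m} → Alike r D E Zs Ws → ∀ {α β xs Xs ys Ys} →
              Represents {D} {d} Zs α β xs Xs → Represents {E} {e} Ws α β ys Ys →
              Sat (bushTree D d) xs Xs φ → Sat (bushTree E e) ys Ys φ
  alike-sat (x ≤̇ y) _ alike rep rep′ (lift s) =
    lift (from (represents-≤ rep′ x y) (alike-reaches alike _ _ (to (represents-≤ rep x y) s)))
  alike-sat (x ∈̇ X) _ alike rep rep′ (lift s) =
    lift (from (represents-∈ rep′ x X) (alike-meets alike _ _ (to (represents-∈ rep x X) s)))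
  alike-sat (¬̇ φ) ok alike rep rep′ ¬s s = ¬s (alike-sat φ ok (alike-sym alike) rep′ rep s)
  alike-sat (φ ∧̇ ψ) ok alike rep rep′ (s , s′) =
    alike-sat φ (≤-trans (m≤m⊔n _ _) ok) alike rep rep′ s ,
    alike-sat ψ (≤-trans (m≤n⊔m (rank φ) _) ok) alike rep rep′ s′
  alike-sat (∃₁̇ φ) (s≤s (s≤s (s≤s ok))) alike rep rep′ (τ@(x , x∈) , s) =
    let Y , alike₁ = alike-extend alike (_≡ x) (λ { refl → x∈ })
        y , Y≐ = alike-singleton alike₁ (id , id)
    in (y , inʳ alike₁ zero {y} (proj₂ Y≐ refl)) ,
       alike-sat φ (≤-trans ok (m≤n+m _ 2)) alike₁ (represents-node rep τ (id , id)) (represents-node rep′ _ Y≐) s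
  alike-sat (∃₂̇ φ) (s≤s ok) alike rep rep′ (X , X⊆ , s) =
    let Y , alike₁ = alike-extend alike X X⊆ in
    Y , (λ {w} → inʳ alike₁ zero {w}) , alike-sat φ ok alike₁ (represents-set rep X) (represents-set rep′ Y) s

  atLeast-U : ∀ n {A : Pred ℕ 0ℓ} → (∀ x → A x) → AtLeast n A
  atLeast-U n all = atLeast-⊆ n {_< n} (λ {x} _ → all x) (atLeast-< n)

  -- Without parameters all branches share one type, and both bushes have at least threshold many.
  alike-start : ∀ r {n} → threshold r 0 ≤ n → Alike r U (_< n) [] []
  alike-start r ok .inˡ ()
  alike-start r ok .inʳ ()
  alike-start r ok .roots ()
  alike-start r {n} ok .types t with toℕ (branchType r []) ≟ₙ t
  ... | yes e = equinumerous-many (atLeast-U (threshold r 0) (λ _ → tt , e))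
                  (atLeast-⊆ (threshold r 0) (λ x< → ≤-trans x< ok , e) (atLeast-< (threshold r 0)))
  ... | no ¬e = equinumerous-empty (λ _ (_ , e) → ¬e e) (λ _ (_ , e) → ¬e e)

  finiteRootFormula-means : ∀ K → Means K [] [] finiteRootFormula (∃[ X ] X ∈ Range WMTL (tree K) × CoversTop K X)
  finiteRootFormula-means K = means-∃₂ λ _ → means-∀₁ λ _ → means-⇒
    (means-¬ (means-∃₁ λ _ → means-∧ means-≤ (means-∧ (means-∃₁ λ _ → means-¬ means-≤) (means-¬ means-≤)))) means-∈

  finite-bush : ∀ n d → bushTree (_< n) d ⊨ finiteRootFormula
  finite-bush n d = complete (finiteRootFormula-means (bushTree (_< n) d)) (X , (X⊆ , X-tree , fin) , top)
    where
    X : WordSet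
    X []          = ⊤
    X (i ∷ [])    = i < n
    X (_ ∷ _ ∷ _) = ⊥
    X⊆ : X ⊆ Bush (_< n)
    X⊆ {[]}     _  = tt
    X⊆ {i ∷ []} i< = i<
    X-tree : IsTree X
    X-tree = [] , tt , (λ _ → []) , prefix-closed
      where
      prefix-closed : ∀ {τ τ′} → τ ∈ X → τ′ ≼ τ → τ′ ∈ X
      prefix-closed {τ = τ}      τ∈ []          = tt
      prefix-closed {τ = i ∷ []} τ∈ (refl ∷ []) = τ∈
    fin : Finite X
    fin = covered⇒finite ([] ∷ map (_∷ []) (upTo n)) λ {w} → cover w
      where
      cover : ∀ w → w ∈ X → w ∈ˡ ([] ∷ map (_∷ []) (upTo n))
      cover []       _  = here refl
      cover (i ∷ []) i< = there (∈-map⁺ (_∷ []) (∈-upTo⁺ i<))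
    top : CoversTop (bushTree (_< n) d) X
    top ([] , _)        _     = tt
    top (i ∷ [] , i<)   _     = i<
    top (i ∷ a ∷ w , i<) ¬deep = ¬deep ((i ∷ [] , i<) , refl ∷ [] , (([] , tt) , λ ()) , λ { (_ ∷ ()) })

  infinite-bush : ∀ d → ¬ bushTree U d ⊨ finiteRootFormula
  infinite-bush d s =
    let X , (_ , _ , fin) , top = sound (finiteRootFormula-means (bushTree U d)) s
        -- The children of the root all have length 1, but their letter sums are unbounded.
        N , bound = finite-bounded sum fin
        shallow : ∀ i → ¬ Deep (bushTree U d) (i ∷ [])
        shallow i = λ { (_ , [] , (_ , ¬≼) , _) → ¬≼ [] ; (_ , refl ∷ [] , _ , ¬≼) → ¬≼ (refl ∷ []) }
    in <-irrefl refl (subst (_≤ N) (+-identityʳ (suc N)) (bound (top (suc N ∷ [] , tt) (shallow (suc N)))))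

  WMTL≰MSO : ¬ (WMTL ≤[ AllKripkeTrees ] MSO)
  WMTL≰MSO le with le 0 finiteRootFormula
  ... | ψ , finite⇔ψ = infinite-bush (0 , tt) (from (finite⇔ψ _ tt)
    (alike-sat {e = 0 , tt} ψ ≤-refl (alike-sym (alike-start (rank ψ) ≤-refl)) rep rep
      (to (finite⇔ψ (bushTree (_< n) child) tt) (finite-bush n child))))
    where
    n = threshold (rank ψ) 0
    child : ∃[ i ] i < n
    child = 0 , 1≤threshold (rank ψ) 0
    rep : ∀ {D d} → Represents {D} {d} [] (λ ()) (λ ()) [] []
    rep .nodes ()
    rep .sets ()

  -- MTL ≰ WMSO

  module _ (T : Fin 2 → List Bool → Bool) where

    Tr-dual : ∀ c → ¬ Tr T c → Tr T (dual c)
    Tr-dual (lit a w b)    ¬t = ¬-not ¬t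
    Tr-dual (const false)  ¬t = refl
    Tr-dual (const true)   ¬t = contradiction refl ¬t
    Tr-dual (node true f)  ¬t = λ n → Tr-dual (f n) λ t → ¬t (n , t)
    Tr-dual (node false f) ¬t = dne λ none → ¬t λ n → dne λ ¬tₙ → none (n , Tr-dual (f n) ¬tₙ)

    -- At a disjunction, the first option is entered if true and discarded otherwise.
    choose : ∀ c → Tr T c → ∃[ d ] (Legal T c d × Tr T (step c d))
    choose (lit a w b)    t = false , tt , t
    choose (const b)      t = false , tt , t
    choose (node false f) t = false , tt , t 0
    choose (node true f)  t with em {P = Tr T (f 0)}
    choose (node true f)  t           | yes t₀ = false , tt , t₀
    choose (node true f)  (zero , t)  | no ¬t₀ = contradiction t ¬t₀
    choose (node true f)  (suc n , t) | no ¬t₀ = true , ¬t₀ , n , t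

    -- Induction on the code. A disjunction cannot be postponed forever, staying at a conjunction is
    -- bright, and a true literal is bright once the position is long enough.
    settles : ∀ c → Settles T c
    settles (lit a w b) l Π lf strat =
      let u , u∈ , w<u = grow lf (suc (length w)) in
      u , u∈ , λ v v∈ → subst (Bright T _) (sym (run-lit a w b (u ++ v)))
        (≤-trans w<u (≤-trans (subst (length u ≤_) (sym (length-++ u)) (m≤m+n _ _)) (m≤n+m _ l)) ,
         strat [] (nonEmpty lf))
    settles (const b) l Π lf strat =
      [] , nonEmpty lf , λ v _ → subst (Bright T _) (sym (run-const b v)) (strat [] (nonEmpty lf))
    settles (node true f) l Π lf strat =
      let n , t = strat [] (nonEmpty lf) in settles-true T f (settles ∘ f) n t l Π lf strat
    -- Either some play in Π enters an option and is settled inside it, or all of Π stays at the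
    -- conjunction.
    settles (node false f) l Π lf strat with em {P = ∃[ n ] Exit T Π n}
    ... | yes (n , exit) = settles-exit T n f (settles ∘ f) l Π lf strat exit
    ... | no ¬exit       =
      [] , nonEmpty lf , λ v → stays T f Π (closed lf) (λ n e → ¬exit (n , e)) _ v

  binary-finitelyBranching : ∀ {n} (T : Fin n → List Bool → Bool) → FinitelyBranching (tree (binaryTree T))
  binary-finitelyBranching T (u , refl) = covered⇒finite (toWord u ∷ʳ 0 ∷ toWord u ∷ʳ 1 ∷ []) child
    where
    child : ∀ {τ} → τ ∈ Children Binary (toWord u) → τ ∈ˡ (toWord u ∷ʳ 0 ∷ toWord u ∷ʳ 1 ∷ [])
    child ((v , refl) , n , e) with toWord-++⁻ u {v} (n ∷ []) e
    ... | false ∷ [] , _ , refl = here e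
    ... | true ∷ []  , _ , refl = there (here e)

  module _ (K : KripkeTree 2) where

    gameFormula-means : Means K [] [] gameFormula (∃[ S ] S ∈ Range MTL (tree K) × Winning K S)
    gameFormula-means = means-∃₂ λ _ → means-∧
      (means-∃₁ λ _ → means-∧ means-∈ (means-∀₁ λ _ → means-≤)) (means-∧
      (means-∀₁ λ _ → means-⇒ means-∈ (means-∧
        (means-⇒ means-P (means-∃₁ λ _ → means-∧ means-∈ means-<))
        (means-⇒ (means-¬ means-P) (means-∀₁ λ _ → means-⇒ means-<
          (means-∃₁ λ _ → means-∧ means-∈ (means-∧ means-< means-≤))))))
      (means-∀₂ λ _ → means-⇒
        (means-∀₁ λ _ → means-⇒ means-∈ (means-∧ means-∈ (means-∃₁ λ _ → means-∧ means-∈ means-<)))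
        (means-∃₁ λ _ → means-∧ means-∈ means-P)))

  module _ (c₀ : Code) where

    open SelfReference c₀

    win : Tr T c₀ → ∃[ S ] S ∈ Range MTL Binary × Winning K S
    win t = S , ((λ { (u , e , _) → u , e }) , S-tree) ,
      (((_ , [] , refl) , ([] , refl , t) , λ _ → []) , local , plays)
      where
      Str = Strategy T c₀
      S = image Str
      S-tree : IsTree S
      S-tree = image-isTree Str [] t (λ _ → []) (strategy-closed T c₀)
      go : ∀ {u d} → Str u → Legal T (run c₀ u) d × Tr T (step (run c₀ u) d) → toWord (u ∷ʳ d) ∈ S
      go {u} {d} s lt = u ∷ʳ d , refl , strategy-extend T c₀ u d s lt
      succ≺ : ∀ u d → toWord u ≺ toWord (u ∷ʳ d)
      succ≺ u d = subst (λ v → toWord u ≺ toWord v) (++-identityʳ _) (toWord-≺ u d [])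
      local : (τ@(x , _) : Node K) → x ∈ S →
           (Labelled K zero τ → Σ[ (y , _) ∈ Node K ] y ∈ S × x ≺ y)
           × (¬ Labelled K zero τ → ((y , _) : Node K) → x ≺ y →
                Σ[ (z , _) ∈ Node K ] z ∈ S × x ≺ z × z ≼ y)
      local (_ , x∈) (u , refl , s) =
        (λ _ → let d , lt = choose T (run c₀ u) (strategy-end T c₀ u s) in
           (toWord (u ∷ʳ d) , u ∷ʳ d , refl) , go s lt , succ≺ u d) ,
        other
        where
        other : ¬ Labelled K zero (toWord u , x∈) → ((y , _) : Node K) → toWord u ≺ y →
                Σ[ (z , _) ∈ Node K ] z ∈ S × toWord u ≺ z × z ≼ y
        other ¬own (_ , v , refl) u≺v with toWord-≺⁻ u u≺v
        ... | d , r , refl = (toWord (u ∷ʳ d) , u ∷ʳ d , refl) ,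
          go s (allow T (run c₀ u) (¬-not λ own → ¬own (from (owner-label u x∈) own)) (strategy-end T c₀ u s) d) ,
          succ≺ u d , toWord-≼ (u ∷ʳ d) r
      plays : ∀ Π → Π ∈ Range MTL Binary →
           (((x , _) : Node K) → x ∈ Π → x ∈ S × Σ[ (y , _) ∈ Node K ] y ∈ Π × x ≺ y) →
           Σ[ τ@(x , _) ∈ Node K ] x ∈ Π × Labelled K (suc zero) τ
      plays Π (Π⊆T , t′@(_ , τ₀∈Π , root , _)) leafless with r , refl ← Π⊆T τ₀∈Π =
        -- Π may be rooted anywhere, so settling is applied to the code reached at its root r, with
        -- offset `length r`.
        let v , v∈ , bright = settles T (run c₀ r) (length r) Π′ lf
                                (λ v v∈ → strategy-after T c₀ r v (inStr (r ++ v) v∈))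
            b = bright [] (subst Π′ (sym (++-identityʳ v)) v∈)
            good = bright-glow T (run (run c₀ r) (v ++ [])) b
            u = r ++ v
        in (toWord u , u , refl) , v∈ , from (binary-label T (suc zero) u (u , refl))
             (trans (T-glow u) (trans (cong₂ (glow T)
                (trans (length-++ r) (cong (λ v → length r + length v) (sym (++-identityʳ v))))
                (trans (foldl-++ step c₀ r v) (cong (run (run c₀ r)) (sym (++-identityʳ v))))) good))
        where
        Π′ : List Bool → Set
        Π′ v = toWord (r ++ v) ∈ Π
        inStr : ∀ u → toWord u ∈ Π → Str u
        inStr u u∈ = image-∈⁻ Str (proj₁ (leafless (_ , u , refl) u∈))
        lf : Leafless Π′
        lf .Leafless.nonEmpty     = subst (λ u → toWord u ∈ Π) (sym (++-identityʳ r)) τ₀∈Π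
        lf .Leafless.closed u v i = subtree-closed t′ (r ++ u) v (toWord-≼ r u)
                                      (subst (λ u → toWord u ∈ Π) (sym (++-assoc r u v)) i)
        lf .Leafless.extend u i with (y , v , refl) , y∈ , u≺y ← proj₂ (leafless (_ , r ++ u , refl) i) =
          map₂ (subst (λ u → toWord u ∈ Π) (++-assoc r u _)) (subtree-child t′ (r ++ u) {v} i y∈ u≺y)

    -- Against any S the opponent follows the strategy for the dual code. The positions common to
    -- both are leafless, and once settled they form a subtree without label 1.
    lose : Tr T (dual c₀) → ∀ S → S ∈ Range MTL Binary → ¬ Winning K S
    lose t S (S⊆T , S-tree) ((_ , []∈S , root) , local , plays) with [] ← root ([] , [] , refl) =
      let u , u∈ , bright = settles T (dual c₀) 0 Π lf (λ _ → proj₂)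
          Π₁ : List Bool → Set
          Π₁ w = toWord u ≼ toWord w × Π w
          (_ , w∈T) , w∈ , good = plays (image Π₁)
            ((λ { (w , e , _) → w , e }) ,
             image-isTree Π₁ u (≼-refl , u∈) proj₁ λ w v (_ , i) → toWord-≼ u w , closed lf (u ++ w) v i)
            (λ { _ (w , refl , u≼w , w∈@(w∈S , _)) → w∈S ,
                 let d , wd∈ = extend lf w w∈ in
                 (_ , w ∷ʳ d , refl) , (w ∷ʳ d , refl , ≼-trans u≼w (toWord-≼ w _) , wd∈) , succ≺ w d })
      in dark u bright w∈T w∈ good
      where
      open Leafless
      Str = Strategy T (dual c₀)
      Π : List Bool → Set
      Π u = toWord u ∈ S × Str u
      root≼ : ∀ w → proj₁ S-tree ≼ w
      root≼ w = ≼-trans (proj₁ (proj₂ (proj₂ S-tree)) []∈S) []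
      succ≺ : ∀ u d → toWord u ≺ toWord (u ∷ʳ d)
      succ≺ u d = subst (λ v → toWord u ≺ toWord v) (++-identityʳ _) (toWord-≺ u d [])
      dark : ∀ u → (∀ v → Π (u ++ v) → Bright T (length (u ++ v)) (run (dual c₀) (u ++ v))) →
             ∀ {x} (x∈T : x ∈ Binary) → x ∈ image (λ w → toWord u ≼ toWord w × Π w) →
             ¬ Labelled K (suc zero) (x , x∈T)
      dark u bright x∈T (w , refl , u≼w , w∈) good with toWord-≼⁻ u u≼w
      ... | v , refl = contradiction (trans (sym (to (binary-label T (suc zero) w x∈T) good))
        (trans (T-glow w) (bright-dual T (run c₀ w)
          (subst (Bright T _) (sym (dual-run c₀ w)) (bright v w∈))))) λ ()
      lf : Leafless Π
      lf .nonEmpty = []∈S , t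
      lf .closed u v (i , s) = subtree-closed S-tree u v (root≼ _) i , strategy-closed T (dual c₀) u v s
      -- At a disjunction of c₀ the set S provides a successor and the dual code allows any move;
      -- otherwise the dual code chooses and S contains all successors.
      lf .extend u (i , s) with owner (run c₀ u) in own
      ... | true with (y , v , refl) , y∈ , u≺y
                      ← proj₁ (local (_ , u , refl) i) (from (owner-label u (u , refl)) own) =
        let d , ud∈ = subtree-child S-tree u {v} i y∈ u≺y in
        d , ud∈ , strategy-extend T (dual c₀) u d s
          (allow T _ (subst (λ c → owner c ≡ false) (dual-run c₀ u) (owner-dual (run c₀ u) own))
            (strategy-end T (dual c₀) u s) d)
      ... | false with choose T _ (strategy-end T (dual c₀) u s)
      ...   | d , lt with proj₂ (local (_ , u , refl) i)
                            (λ l → contradiction (trans (sym own) (to (owner-label u (u , refl)) l)) λ ())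
                            (_ , u ∷ʳ d , refl) (succ≺ u d)
      ...     | (z , w , refl) , z∈ , u≺z , z≼ = d , ud∈ , strategy-extend T (dual c₀) u d s lt
        where
        -- S is only known to contain some z strictly below u that is a prefix of the child; such a
        -- z must begin with that child.
        ud∈ : toWord (u ∷ʳ d) ∈ S
        ud∈ with toWord-≺⁻ u u≺z
        ... | e , r , refl with toWord-≼⁻ ((u ∷ʳ e) ++ r) z≼
        ... | q , eq with ++-cancelˡ u (d ∷ []) (e ∷ r ++ q)
                            (trans eq (trans (++-assoc (u ∷ʳ e) r q) (++-assoc u (e ∷ []) (r ++ q))))
        ... | eq′ with ∷-injective eq′
        ... | refl , _ = subtree-closed S-tree (u ∷ʳ e) r (root≼ _) z∈

  -- Conditions that do not involve labels are decided at once and become constants.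
  truth : Set → Bool → Code
  truth A true  = const (does (em {P = A}))
  truth A false = const (not (does (em {P = A})))

  -- The negation normal form of φ (for b = true) or of its negation (for b = false) over a binary
  -- tree, as a well-founded game.
  compile : ∀ {p q} → Formula WMSO 2 p q → Bool → Vec (List Bool) p → Vec (List (List Bool)) q → Code
  compile (P a x)  b ρ σ = lit a (lookup ρ x) b
  compile (x ≤̇ y)  b ρ σ = truth (toWord (lookup ρ x) ≼ toWord (lookup ρ y)) b
  compile (x ∈̇ X)  b ρ σ = truth (lookup ρ x ∈ˡ lookup σ X) b
  compile (¬̇ φ)    b ρ σ = compile φ (not b) ρ σ
  compile (φ ∧̇ ψ)  b ρ σ = node (not b) (either (compile φ b ρ σ) (compile ψ b ρ σ))
  compile (∃₁̇ φ)   b ρ σ = node b λ n → compile φ b (enumWord n ∷ ρ) σ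
  compile (∃₂̇ φ)   b ρ σ = node b λ n → compile φ b ρ (enumWords n ∷ σ)

  module _ (T : Fin 2 → List Bool → Bool) where

    truth-true : ∀ {A} → A → Tr T (truth A true)
    truth-true a = dec-true em a

    truth-false : ∀ {A} → ¬ A → Tr T (truth A false)
    truth-false ¬a = cong not (dec-false em ¬a)

    truth-exclusive : ∀ A → Tr T (truth A true) → ¬ Tr T (truth A false)
    truth-exclusive A t t′ = contradiction (trans (sym (cong not t)) t′) λ ()

    -- Turns truth of the code for φ into falsity of the code for its negation, whose dual is then
    -- true by `Tr-dual`.
    compile-exclusive : ∀ {p q} (φ : Formula WMSO 2 p q) ρ σ →
                        Tr T (compile φ true ρ σ) → ¬ Tr T (compile φ false ρ σ)
    compile-exclusive (P a x)  ρ σ t t′            = not-¬ t t′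
    compile-exclusive (x ≤̇ y)  ρ σ t t′            = truth-exclusive _ t t′
    compile-exclusive (x ∈̇ X)  ρ σ t t′            = truth-exclusive _ t t′
    compile-exclusive (¬̇ φ)    ρ σ t t′            = compile-exclusive φ ρ σ t′ t
    compile-exclusive (φ ∧̇ ψ)  ρ σ t (zero , t′)   = compile-exclusive φ ρ σ (t 0) t′
    compile-exclusive (φ ∧̇ ψ)  ρ σ t (suc _ , t′)  = compile-exclusive ψ ρ σ (t 1) t′
    compile-exclusive (∃₁̇ φ)   ρ σ (n , t) t′      = compile-exclusive φ _ σ t (t′ n)
    compile-exclusive (∃₂̇ φ)   ρ σ (n , t) t′      = compile-exclusive φ ρ _ t (t′ n)

    K₂ : KripkeTree 2
    K₂ = binaryTree T

    Denotes₁ : ∀ {p} → Vec (Node K₂) p → Vec (List Bool) p → Set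
    Denotes₁ xs ρ = ∀ i → proj₁ (lookup xs i) ≡ toWord (lookup ρ i)

    Denotes₂ : ∀ {q} → Vec WordSet q → Vec (List (List Bool)) q → Set
    Denotes₂ Xs σ = ∀ j → lookup Xs j ≐ image (_∈ˡ lookup σ j)

    compile-true : ∀ {p q} (φ : Formula WMSO 2 p q) {xs Xs ρ σ} → Denotes₁ xs ρ → Denotes₂ Xs σ →
                   Sat K₂ xs Xs φ → Tr T (compile φ true ρ σ)
    compile-false : ∀ {p q} (φ : Formula WMSO 2 p q) {xs Xs ρ σ} → Denotes₁ xs ρ → Denotes₂ Xs σ →
                    ¬ Sat K₂ xs Xs φ → Tr T (compile φ false ρ σ)

    extend₁ : ∀ {p} {xs : Vec (Node K₂) p} {ρ} → Denotes₁ xs ρ → ∀ {τ u} → proj₁ τ ≡ toWord u →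
              Denotes₁ (τ ∷ xs) (u ∷ ρ)
    extend₁ d₁ e zero    = e
    extend₁ d₁ e (suc i) = d₁ i

    extend₂ : ∀ {q} {Xs : Vec WordSet q} {σ} → Denotes₂ Xs σ → ∀ {X us} → X ≐ image (_∈ˡ us) →
              Denotes₂ (X ∷ Xs) (us ∷ σ)
    extend₂ d₂ e zero    = e
    extend₂ d₂ e (suc i) = d₂ i

    atom-P : ∀ {p} (xs : Vec (Node K₂) p) ρ → Denotes₁ xs ρ → ∀ a x → let τ = lookup xs x in
             (a ∈ˢ label K₂ (proj₁ τ) (proj₂ τ)) ⇔ (T a (lookup ρ x) ≡ true)
    atom-P xs ρ d₁ a x with lookup xs x | d₁ x
    ... | _ , τ∈ | refl = binary-label T a (lookup ρ x) τ∈

    atom-∈ : ∀ {p q} (xs : Vec (Node K₂) p) (Xs : Vec WordSet q) ρ σ → Denotes₁ xs ρ → Denotes₂ Xs σ →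
             ∀ x X → (proj₁ (lookup xs x) ∈ lookup Xs X) ⇔ (lookup ρ x ∈ˡ lookup σ X)
    atom-∈ xs Xs ρ σ d₁ d₂ x X rewrite d₁ x = mk⇔
      (λ i → image-∈⁻ (_∈ˡ lookup σ X) (proj₁ (d₂ X) i))
      (λ i → proj₂ (d₂ X) (_ , refl , i))

    finite-image : ∀ {X} → X ⊆ Binary → Finite X → ∃[ us ] X ≐ image (_∈ˡ us)
    finite-image {X} X⊆T (τs , X⊆τs , τs⊆X) = map fromWord τs ,
      (λ x∈ → let u , e = X⊆T x∈ in
         u , e , subst (_∈ˡ map fromWord τs) (trans (cong fromWord e) (from-to u)) (∈-map⁺ fromWord (X⊆τs x∈))) ,
      back
      where
      back : image (_∈ˡ map fromWord τs) ⊆ X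
      back (u , refl , u∈) with ∈-map⁻ fromWord u∈
      ... | τ , τ∈ , refl with X⊆T (τs⊆X τ∈)
      ... | v , refl = subst (λ w → toWord w ∈ X) (sym (from-to v)) (τs⊆X τ∈)

    image-finite : ∀ us → image (_∈ˡ us) ∈ Range WMSO Binary
    image-finite us = (λ (u , e , _) → u , e) , map toWord us ,
      (λ { (u , refl , u∈) → ∈-map⁺ toWord u∈ }) ,
      (λ x∈ → let u , u∈ , e = ∈-map⁻ toWord x∈ in u , e , u∈)

    compile-true (P a x) {xs} {ρ = ρ} d₁ d₂ (lift s) = to (atom-P xs ρ d₁ a x) s
    compile-true (x ≤̇ y) d₁ d₂ (lift s) = truth-true (subst₂ _≼_ (d₁ x) (d₁ y) s)
    compile-true (x ∈̇ X) {xs} {Xs} {ρ} {σ} d₁ d₂ (lift s) = truth-true (to (atom-∈ xs Xs ρ σ d₁ d₂ x X) s)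
    compile-true (¬̇ φ)   d₁ d₂ s = compile-false φ d₁ d₂ s
    compile-true (φ ∧̇ ψ) d₁ d₂ (s , s′) zero    = compile-true φ d₁ d₂ s
    compile-true (φ ∧̇ ψ) d₁ d₂ (s , s′) (suc _) = compile-true ψ d₁ d₂ s′
    compile-true (∃₁̇ φ) {xs} {ρ = ρ} d₁ d₂ ((x , u , e) , s) =
      let n , e′ = enumWord-surjective u in
      n , compile-true φ (extend₁ {xs = xs} {ρ} d₁ (trans e (cong toWord (sym e′)))) d₂ s
    compile-true (∃₂̇ φ) {Xs = Xs} {σ = σ} d₁ d₂ (X , (X⊆T , fin) , s) =
      let us , X≐ = finite-image X⊆T fin ; n , e = enumWords-surjective us in
      n , compile-true φ d₁ (extend₂ {Xs = Xs} {σ} d₂ (subst (λ us → X ≐ image (_∈ˡ us)) (sym e) X≐)) s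

    compile-false (P a x) {xs} {ρ = ρ} d₁ d₂ ¬s = ¬-not (¬s ∘ lift ∘ from (atom-P xs ρ d₁ a x))
    compile-false (x ≤̇ y) d₁ d₂ ¬s = truth-false (¬s ∘ lift ∘ subst₂ _≼_ (sym (d₁ x)) (sym (d₁ y)))
    compile-false (x ∈̇ X) {xs} {Xs} {ρ} {σ} d₁ d₂ ¬s =
      truth-false (¬s ∘ lift ∘ from (atom-∈ xs Xs ρ σ d₁ d₂ x X))
    compile-false (¬̇ φ)   d₁ d₂ ¬s = compile-true φ d₁ d₂ (dne ¬s)
    compile-false (φ ∧̇ ψ) {xs} {Xs} d₁ d₂ ¬s with em {P = Sat K₂ xs Xs φ}
    ... | yes s = 1 , compile-false ψ d₁ d₂ (¬s ∘ (s ,_))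
    ... | no ¬s′ = 0 , compile-false φ d₁ d₂ ¬s′
    compile-false (∃₁̇ φ) {xs} {ρ = ρ} d₁ d₂ ¬s n =
      compile-false φ (extend₁ {xs = xs} {ρ} d₁ refl) d₂ (¬s ∘ ((toWord (enumWord n) , _ , refl) ,_))
    compile-false (∃₂̇ φ) {Xs = Xs} {σ = σ} d₁ d₂ ¬s n =
      compile-false φ d₁ (extend₂ {Xs = Xs} {σ} d₂ (id , id)) (λ s → ¬s (_ , image-finite (enumWords n) , s))

  MTL≰WMSO : ¬ (MTL ≤[ FinitelyBranchingKripkeTrees ] WMSO)
  MTL≰WMSO le with le 2 gameFormula
  ... | ψ , game⇔ψ = ψ-false ψ-true
    where
    -- The board carries the game for the negation of ψ, so the game formula holds in `K` exactly
    -- when ψ fails there.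
    c₀ = compile ψ false [] []
    open SelfReference c₀
    equivalent : K ⊨ gameFormula ⇔ K ⊨ ψ
    equivalent = game⇔ψ K (binary-finitelyBranching T)
    ψ-false : ¬ K ⊨ ψ
    ψ-false s =
      let S , S∈ , winning = sound (gameFormula-means K) (from equivalent s) in
      lose c₀ (Tr-dual T c₀ (compile-exclusive T ψ [] [] (compile-true T ψ (λ ()) (λ ()) s))) S S∈ winning
    ψ-true : K ⊨ ψ
    ψ-true = dne λ ¬s → ¬s (to equivalent (complete (gameFormula-means K)
      (win c₀ (compile-false T ψ (λ ()) (λ ()) ¬s))))

  -- WMSO ≰ MTL

  greatest-below : ∀ {m} (v : Vec ℕ m) x → (∃[ i ] lookup v i < x) →
                   ∃[ l ] lookup v l < x × ∀ j → lookup v j < x → lookup v j ≤ lookup v l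
  greatest-below (a ∷ v) x (i , i<x) with em {P = ∃[ k ] lookup v k < x}
  greatest-below (a ∷ v) x (zero , a<x)  | no none = zero , a<x ,
    λ { zero _ → ≤-refl ; (suc j) j<x → contradiction (j , j<x) none }
  greatest-below (a ∷ v) x (suc i , i<x) | no none = contradiction (i , i<x) none
  greatest-below (a ∷ v) x (i , i<x)     | yes below
    with greatest-below v x below | em {P = a < x × lookup v (proj₁ (greatest-below v x below)) ≤ a}
  ... | l , l<x , max | yes (a<x , l≤a) = zero , a<x ,
    λ { zero _ → ≤-refl ; (suc j) j<x → ≤-trans (max j j<x) l≤a }
  ... | l , l<x , max | no ¬a = suc l , l<x ,
    λ { zero a<x → ≰⇒≥ (λ l≤a → ¬a (a<x , l≤a)) ; (suc j) j<x → max j j<x }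

  -- If x lies within N of an entry, the distance is copied. Otherwise y is put N + 1 above the
  -- counterpart of the greatest entry below x.
  close-extend : ∀ {N m} {v v′ : Vec ℕ m} → Close (next N) v v′ →
                 ∀ {c} → lookup v c ≡ 0 → lookup v′ c ≡ 0 →
                 ∀ x → ∃[ y ] Close N (x ∷ v) (y ∷ v′)
  close-extend {N} {v = v} {v′} close {c₀} v₀ v′₀ x
    with em {P = ∃[ k ] ∃[ c ] ∃[ c′ ] (c ≤ N × c′ ≤ N × c + x ≡ c′ + lookup v k)}
  ... | yes (k , c , c′ , c≤ , c′≤ , e) =
    y , close-cons close (λ j → anchored close c≤ c′≤ e (m+[n∸m]≡n c≤v′) j)
    where
    -- The subtraction in y does not truncate: comparison with the listed position 0 transfers this
    -- bound.
    c≤v′ : c ≤ c′ + lookup v′ k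
    c≤v′ = subst (_≤ _) (trans (cong (c +_) v′₀) (+-identityʳ c)) (ordered (proj₁ close) c₀ k c c′
      (≤-trans c≤ (n≤next N)) (≤-trans c′≤ (n≤next N))
      (subst₂ _≤_ (sym (trans (cong (c +_) v₀) (+-identityʳ c))) e (m≤m+n c x)))
    y = c′ + lookup v′ k ∸ c
  ... | no far = y , close-cons close λ j → separated (sep j)
    where
    side : ∀ j → (N + lookup v j < x) ⊎ (N + x < lookup v j)
    side j with N + lookup v j <? x | N + x <? lookup v j
    ... | yes p | _     = inj₁ p
    ... | no _  | yes q = inj₂ q
    ... | no ¬p | no ¬q = contradiction (close-by (≤-total x (lookup v j))) far
      where
      within : ∀ {a} b → a ≤ N + b → a ∸ b ≤ N
      within b a≤ = ≤-trans (∸-monoˡ-≤ b a≤) (≤-reflexive (m+n∸n≡m N b))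
      close-by : x ≤ lookup v j ⊎ lookup v j ≤ x → ∃[ k ] ∃[ c ] ∃[ c′ ] (c ≤ N × c′ ≤ N × c + x ≡ c′ + lookup v k)
      close-by (inj₁ x≤) = j , lookup v j ∸ x , 0 , within x (≮⇒≥ ¬q) , z≤n , m∸n+n≡m x≤
      close-by (inj₂ ≤x) = j , 0 , x ∸ lookup v j , z≤n , within (lookup v j) (≮⇒≥ ¬p) , sym (m∸n+n≡m ≤x)
    root<x : lookup v c₀ < x
    root<x with side c₀
    ... | inj₁ p = ≤-trans (s≤s (m≤n+m _ N)) p
    ... | inj₂ q = contradiction (subst (N + x <_) v₀ q) λ ()
    best = greatest-below v x (c₀ , root<x)
    l = proj₁ best
    y = suc N + lookup v′ l
    sep : ∀ j → (N + lookup v j < x × N + lookup v′ j < y) ⊎ (N + x < lookup v j × N + y < lookup v′ j)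
    sep j with side j
    ... | inj₁ p = inj₁ (p , s≤s (+-monoʳ-≤ N (close-≤ close j l (proj₂ (proj₂ best) j (≤-trans (s≤s (m≤n+m _ N)) p)))))
    -- Entry j exceeds entry l by at least 2(N + 1), a gap that transfers and leaves more than N
    -- above y.
    ... | inj₂ q = inj₂ (q , subst (_≤ lookup v′ j) (+-assoc (suc N) (suc N) _)
      (ordered (proj₁ close) l j (suc N + suc N) 0 ≤-refl z≤n
        (subst (_≤ lookup v j) (sym (+-assoc (suc N) (suc N) _))
        (≤-trans (+-monoʳ-≤ (suc N) l<) q))))
      where
      l< : N + lookup v l < x
      l< with side l
      ... | inj₁ p  = p
      ... | inj₂ q′ = contradiction (proj₁ (proj₂ best)) (≤⇒≯ (≤-trans (m≤n+m x N) (<⇒≤ q′)))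

  -- A subtree of a chain is convex, and either has a greatest member or is unbounded.
  interval : ∀ {X} → X ⊆ Chain → IsTree X →
             ∃[ l ] ∃[ h ] ∃[ e ] (l ≤ h × ∀ k → (zeros k ∈ X) ⇔ Span l h e k)
  interval {X} X⊆C t@(τ₀ , τ₀∈X , root , _) = by em
    where
    l = length τ₀
    Max : ℕ → Set
    Max h = zeros h ∈ X × ∀ k → zeros k ∈ X → k ≤ h
    l≤ : ∀ k → zeros k ∈ X → l ≤ k
    l≤ k k∈X = subst (l ≤_) (length-replicate k) (≼-length (root k∈X))
    convex : ∀ {k k′} → l ≤ k → k ≤ k′ → zeros k′ ∈ X → zeros k ∈ X
    convex l≤k k≤k′ k′∈X = tree-≼-closed t k′∈X (subst (_≼ _) (sym (X⊆C τ₀∈X)) (zeros-≼ l≤k)) (zeros-≼ k≤k′)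
    beyond : ¬ (∃[ h ] Max h) → ∀ k → ∃[ k′ ] k ≤ k′ × zeros k′ ∈ X
    beyond noMax zero    = l , z≤n , subst X (X⊆C τ₀∈X) τ₀∈X
    beyond noMax (suc k) with beyond noMax k
    ... | k′ , k≤k′ , k′∈X with em {P = ∃[ k″ ] (zeros k″ ∈ X × k′ < k″)}
    ... | yes (k″ , k″∈X , k′<k″) = k″ , ≤-trans (s≤s k≤k′) k′<k″ , k″∈X
    ... | no none = contradiction (k′ , k′∈X , λ k″ k″∈X → ≮⇒≥ λ k′<k″ → none (k″ , k″∈X , k′<k″)) noMax
    by : Dec (∃[ h ] Max h) → ∃[ l ] ∃[ h ] ∃[ e ] (l ≤ h × ∀ k → (zeros k ∈ X) ⇔ Span l h e k)
    by (yes (h , h∈X , max)) = l , h , true , l≤ h h∈X , λ k → mk⇔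
      (λ k∈X → l≤ k k∈X , λ _ → max k k∈X)
      (λ (l≤k , k≤h) → convex l≤k (k≤h refl) h∈X)
    -- The second l is the placeholder for h and makes l ≤ h true.
    by (no noMax) = l , l , false , ≤-refl , λ k → mk⇔
      (λ k∈X → l≤ k k∈X , λ ())
      (λ (l≤k , _) → let k′ , k≤k′ , k′∈X = beyond noMax k in convex l≤k k≤k′ k′∈X)

  chain-finite : ∀ {X N} → X ⊆ Chain → (∀ {w} → w ∈ X → length w ≤ N) → Finite X
  chain-finite {N = N} X⊆C bound = covered⇒finite (map zeros (upTo (suc N))) λ w∈X →
    subst (_∈ˡ map zeros (upTo (suc N))) (sym (X⊆C w∈X)) (∈-map⁺ zeros (∈-upTo⁺ (s≤s (bound w∈X))))

  chain-finitelyBranching : ∀ A → FinitelyBranching (tree (chainTree A))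
  chain-finitelyBranching A {τ} τ∈ = chain-finite {N = suc (length τ)} proj₁
    λ { (_ , n , refl) → ≤-reflexive (trans (length-++ τ) (+-comm (length τ) 1)) }

  -- Ehrenfeucht-Fraïssé argument on lists of positions: `close-extend` answers a node by one
  -- position and a subtree by two end points.
  invariant : ∀ {A B N p q m} (φ : Formula MTL 1 p q) → need φ ≤ N → {v v′ : Vec ℕ m} → Close N v v′ →
              ∀ {xs Xs ys Ys c₀ c₁ α β} →
              Positions A xs Xs v c₀ c₁ α β → Positions B ys Ys v′ c₀ c₁ α β →
              Sat (chainTree A) xs Xs φ → Sat (chainTree B) ys Ys φ
  invariant {A} {B} (P zero x) _ {v} {v′} close {xs} {ys = ys} {c₁ = c₁} {α = α} pos pos′ (lift s) =
    lift (from (marked B (proj₁ (lookup ys x))) (begin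
      length (proj₁ (lookup ys x)) ≡⟨ nodes pos′ x ⟩
      lookup v′ (α x)              ≡⟨ equal (begin
        lookup v (α x)               ≡⟨ nodes pos x ⟨
        length (proj₁ (lookup xs x)) ≡⟨ to (marked A (proj₁ (lookup xs x))) s ⟩
        A                            ≡⟨ mark pos ⟨
        lookup v c₁                  ∎) ⟩
      lookup v′ c₁                 ≡⟨ mark pos′ ⟩
      B                            ∎))
    where
    open ≡-Reasoning
    equal : lookup v (α x) ≡ lookup v c₁ → lookup v′ (α x) ≡ lookup v′ c₁
    equal e = ≤-antisym (close-≤ close _ _ (≤-reflexive e)) (close-≤ close _ _ (≤-reflexive (sym e)))
  invariant (x ≤̇ y) _ close {xs} {ys = ys} {α = α} pos pos′ (lift s) =
    lift (chain-≼ (proj₂ (lookup ys x)) (proj₂ (lookup ys y))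
      (subst₂ _≤_ (sym (nodes pos′ x)) (sym (nodes pos′ y)) (close-≤ close (α x) (α y)
        (subst₂ _≤_ (nodes pos x) (nodes pos y) (≼-length s)))))
  invariant (x ∈̇ X) _ close {xs} {Xs} {ys} {Ys} {α = α} {β} pos pos′ (lift s) =
    let l , h , _ = β X in
    lift (from (chain-∈ {xs = ys} {Ys} pos′ x X)
      (map× (close-≤ close l (α x)) (close-≤ close (α x) h ∘_) (to (chain-∈ {xs = xs} {Xs} pos x X) s)))
  invariant (¬̇ φ) ok close pos pos′ ¬s s = ¬s (invariant φ ok (close-sym close) pos′ pos s)
  invariant (φ ∧̇ ψ) ok close pos pos′ (s , s′) =
    invariant φ (≤-trans (m≤m⊔n _ _) ok) close pos pos′ s ,
    invariant ψ (≤-trans (m≤n⊔m (need φ) _) ok) close pos pos′ s′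
  invariant (∃₁̇ φ) ok close pos pos′ (τ , s) =
    let y , close₁ = close-extend (close-mono ok close) (root pos) (root pos′) (length (proj₁ τ)) in
    (zeros y , zeros∈Chain y) , invariant φ ≤-refl close₁
      (add-node (add-position pos _) τ zero refl)
      (add-node (add-position pos′ y) _ zero (length-replicate y)) s
  invariant (∃₂̇ φ) ok close {c₀ = c₀} pos pos′ (X , (X⊆C , t) , s) =
    let l , h , e , l≤h , X⇔ = interval X⊆C t
        l′ , close₁ = close-extend (close-mono ok close) (root pos) (root pos′) l
        h′ , close₂ = close-extend close₁ {suc c₀} (root pos) (root pos′) h
        l′≤h′ = close-≤ close₂ (suc zero) zero l≤h
        b = (suc zero , zero , e)
    in SpanSet l′ h′ e , (proj₁ , spanSet-isTree l′≤h′) , invariant φ ≤-refl close₂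
         (add-set (add-position (add-position pos l) h) X b X⇔)
         (add-set (add-position (add-position pos′ l′) h′) _ b (zeros∈SpanSet l′ h′ e)) s

  evenFormula-means : ∀ A → Means (chainTree A) [] [] evenFormula (∃[ X ] X ∈ Range WMSO Chain × EvenSteps A X)
  evenFormula-means A = means-∃₂ λ _ → means-∧
    (means-∃₁ λ _ → means-∧ means-∈ (means-∀₁ λ _ → means-≤))
    (means-∀₁ λ _ → means-⇒ means-∈ (means-⇒ (means-¬ means-P) (means-∃₁ λ _ → means-∃₁ λ _ →
       means-∧ covers (means-∧ covers means-∈))))
    where
    covers : ∀ {p q} {xs : Vec (Node (chainTree A)) p} {Xs : Vec WordSet q} {x y} →
             Means (chainTree A) xs Xs (_⋖̇_ {WMSO} x y) (Covers Chain (proj₁ (lookup xs x)) (proj₁ (lookup xs y)))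
    covers = means-∧ means-< (means-¬ (means-∃₁ λ _ → means-∧ means-< means-<))

  even-holds : ∀ M → chainTree (M * 2) ⊨ evenFormula
  even-holds M = complete (evenFormula-means (M * 2)) (X , (X⊆C , chain-finite {N = M * 2} X⊆C bound) ,
    (([] , refl) , (0 , z≤n , refl) , λ _ → []) , steps)
    where
    X : WordSet
    X w = ∃[ j ] (j ≤ M × w ≡ zeros (j * 2))
    X⊆C : X ⊆ Chain
    X⊆C (j , _ , refl) = zeros∈Chain (j * 2)
    bound : ∀ {w} → w ∈ X → length w ≤ M * 2
    bound (j , j≤M , refl) = subst (_≤ _) (sym (length-replicate (j * 2))) (*-monoˡ-≤ 2 j≤M)
    steps : ((x , _) : Σ Word Chain) → x ∈ X → ¬ zero ∈ˢ Marked (M * 2) x →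
           Σ[ (z , _) ∈ Σ Word Chain ] Σ[ (y , _) ∈ Σ Word Chain ] Covers Chain x z × Covers Chain z y × y ∈ X
    steps _ (j , j≤M , refl) ¬mark =
      (zeros (1 + j * 2) , zeros∈Chain _) , (zeros (2 + j * 2) , zeros∈Chain _) ,
      length-covers (j * 2) , length-covers (1 + j * 2) , suc j ,
      ≤∧≢⇒< j≤M (λ { refl → ¬mark (from (marked (M * 2) (zeros (j * 2))) (length-replicate (j * 2))) }) , refl

  -- An even position never carries the mark, so the walk cannot stop and makes X infinite.
  odd-fails : ∀ M → ¬ chainTree (suc (M * 2)) ⊨ evenFormula
  odd-fails M s with sound (evenFormula-means (suc (M * 2))) s
  ... | X , (X⊆C , fin) , ((_ , r∈X , root) , steps) with [] ← root ([] , refl) =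
    let N , bound = finite-bounded length fin in
    <-irrefl refl (≤-trans (m≤m*n (suc N) 2) (subst (_≤ N) (length-replicate (suc N * 2)) (bound (evens (suc N)))))
    where
    evens : ∀ j → zeros (j * 2) ∈ X
    evens zero    = r∈X
    evens (suc j) with steps (zeros (j * 2) , zeros∈Chain _) (evens j) unmarked
      where
      unmarked : ¬ zero ∈ˢ Marked (suc (M * 2)) (zeros (j * 2))
      unmarked i = even≢odd j M (trans (*-comm 2 j) (trans (sym (length-replicate (j * 2)))
        (trans (to (marked (suc (M * 2)) (zeros (j * 2))) i) (cong suc (*-comm M 2)))))
    ... | (z , z∈) , (y , y∈) , cov , cov′ , y∈X = subst X (trans y∈ (cong zeros
      (trans (covers-length z∈ y∈ cov′) (cong suc (trans (covers-length (zeros∈Chain _) z∈ cov)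
        (cong suc (length-replicate (j * 2)))))))) y∈X

  WMSO≰MTL : ¬ (WMSO ≤[ FinitelyBranchingKripkeTrees ] MTL)
  WMSO≰MTL le with le 1 evenFormula
  ... | ψ , even⇔ψ = odd-fails M (from (even⇔ψ _ (chain-finitelyBranching (suc (M * 2))))
    (invariant ψ ≤-refl (close-base N<A (≤-trans N<A (n≤1+n _))) (start (M * 2)) (start (suc (M * 2)))
      (to (even⇔ψ _ (chain-finitelyBranching (M * 2))) (even-holds M))))
    where
    -- Puts both depths, M * 2 and its successor, beyond the precision `need ψ`.
    M = suc (need ψ)
    N<A : need ψ < M * 2
    N<A = m≤m*n M 2
    start : ∀ A → Positions A [] [] (0 ∷ A ∷ []) zero (suc zero) (λ ()) (λ ())
    start A .Positions.root  = refl
    start A .Positions.mark  = refl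
    start A .Positions.nodes = λ ()
    start A .Positions.sets  = λ ()

theorem5 : (∀ {ℓ} → ExcludedMiddle ℓ) →
    ( (MSO ≁[ AllKripkeTrees ] WMSO)
    × (MTL ≁[ AllKripkeTrees ] WMTL)
    × (MSO ≁[ AllKripkeTrees ] WMTL)
    × (MTL ≁[ AllKripkeTrees ] WMSO) )
    × ( (WMSO <[ FinitelyBranchingKripkeTrees ] MSO)
    × (WMTL <[ FinitelyBranchingKripkeTrees ] MTL)
    × (MTL ≁[ FinitelyBranchingKripkeTrees ] WMSO) )
theorem5 em =
  -- Composed with MTL ≤ MSO and WMTL ≤ WMSO, each supposed inclusion yields a refuted one;
  -- inclusions over all trees restrict to the finitely branching ones.
  ( ( (λ le → MTL≰WMSO (restrict (chain MTL≤MSO le))) , (λ le → WMTL≰MSO (chain WMTL≤WMSO le)) )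
  , ( (λ le → MTL≰WMSO (restrict (chain le WMTL≤WMSO))) , (λ le → WMTL≰MSO (chain le MTL≤MSO)) )
  , ( (λ le → MTL≰WMSO (restrict (chain MTL≤MSO (chain le WMTL≤WMSO)))) , WMTL≰MSO )
  , ( (λ le → MTL≰WMSO (restrict le)) , (λ le → WMTL≰MSO (chain WMTL≤WMSO (chain le MTL≤MSO))) ) )
  , ( (WMSO≤MSO , λ le → MTL≰WMSO (chain′ MTL≤MSO le))
    , (WMTL≤MTL , λ le → MTL≰WMSO (chain′ le WMTL≤WMSO))
    , (MTL≰WMSO , WMSO≰MTL) )
  where
  open Classical em
  chain : ∀ {L₁ L₂ L₃} → L₁ ≤[ AllKripkeTrees ] L₂ → L₂ ≤[ AllKripkeTrees ] L₃ → L₁ ≤[ AllKripkeTrees ] L₃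
  chain {L₁} = ≤-trans-logic {AllKripkeTrees} {L₁}
  chain′ : ∀ {L₁ L₂ L₃} → L₁ ≤[ FinitelyBranchingKripkeTrees ] L₂ → L₂ ≤[ FinitelyBranchingKripkeTrees ] L₃ →
           L₁ ≤[ FinitelyBranchingKripkeTrees ] L₃
  chain′ {L₁} = ≤-trans-logic {FinitelyBranchingKripkeTrees} {L₁}
  restrict : ∀ {L L′} → L ≤[ AllKripkeTrees ] L′ → L ≤[ FinitelyBranchingKripkeTrees ] L′
  restrict {L} = ≤-restrict {FinitelyBranchingKripkeTrees} {L}
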